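{- Let $w_m:=d^my$ for $m\in\mathbb{N}_0$. Then for every integer $n\ge2$ and all $k_1,\dots,k_n\in\mathbb{N}_0$, the following holds in $\mathcal{H}_0\otimes\mathcal{H}_0$: $$\tilde{\Delta}_0(w_{k_1}\cdots w_{k_n})=\sum_{i_1+j_1=k_1}\binom{k_1}{i_1}\,d^{i_1}y\otimes_{\mathrm{sym}}d^{j_1}w_{k_2}\cdots w_{k_n}$$ $$+\sum_{p=2}^{n-1}\ \sum_{\substack{i_1+j_1=k_1\\ \vdots\\ i_p+j_p=k_p}}\ \prod_{a=1}^p\binom{k_a}{i_a}\sum_{\substack{\{u_q,v_q\}=\{d^{i_q},\,d^{j_q}y\}\\ 1\le q\le p-1}}\bigl(u_1\cdots u_{p-1}d^{i_p}y\otimes_{\mathrm{sym}}v_1\cdots v_{p-1}d^{j_p}w_{k_{p+1}}\cdots w_{k_n}\bigr).$$ Here $i_a,j_a$ range over $\mathbb{N}_0$, and the innermost sum is over all choices, for each $1\le q\le p-1$, of $(u_q,v_q)=(d^{i_q},d^{j_q}y)$ or $(u_q,v_q)=(d^{j_q}y,d^{i_q})$.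
   Context: $\mathbb{N}_0=\{0,1,2,\dots\}$. Let $L=\{d,y\}$, let $L^*$ be the free monoid on $L$ with unit the empty word $\mathbf{1}$, and $\mathbb{Q}\langle L\rangle$ the $\mathbb{Q}$-span of $L^*$. Put $Y:=L^*y\cup\{\mathbf{1}\}$. Define a $\mathbb{Q}$-bilinear product $\sqcup\!\sqcup_0$ on $\mathbb{Q}\langle L\rangle$ recursively, for words $u,v,w\in L^*$, by $\mathbf 1\sqcup\!\sqcup_0 w=w\sqcup\!\sqcup_0\mathbf 1=w$; $\ yu\sqcup\!\sqcup_0 v=u\sqcup\!\sqcup_0 yv=y(u\sqcup\!\sqcup_0 v)$; $\ du\sqcup\!\sqcup_0 dv=d(u\sqcup\!\sqcup_0 dv)-u\sqcup\!\sqcup_0 d^2v$. Let $\mathcal{T}_-$ be the linear span of $\{wd\mid w\in L^*\}$; let $\mathcal{L}_-$ be the two-sided ideal of $(\mathbb{Q}\langle L\rangle,\sqcup\!\sqcup_0)$ generated by all $d^k\{d(u\sqcup\!\sqcup_0 v)-du\sqcup\!\sqcup_0 v-u\sqcup\!\sqcup_0 dv\}$ with $k\in\mathbb{N}_0$, $u,v\in L^*$; put $\mathcal{S}_-:=\mathcal{T}_-+\mathcal{L}_-$ (a two-sided ideal) and $\mathcal{H}_0:=\mathbb{Q}\langle L\rangle/\mathcal{S}_-$. Words are identified with their classes in $\mathcal{H}_0$. It is known (Ebrahimi-Fard–Manchon–Singer) that $\mathcal{H}_0$ is a connected filtered commutative and cocommutative Hopf algebra with product $\sqcup\!\sqcup_0$,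 unit $1=\mathbf 1$, and coproduct given, for $w=x_1\cdots x_N\in Y\setminus\{\mathbf 1\}$ ($x_i\in L$), by $\Delta_0(w)=\sum_{S}w_S\otimes w_{\overline S}$, the sum being over all $S\subset\{1,\dots,N\}$ (possibly empty) such that $w_S,w_{\overline S}\in Y$, where $\overline S$ is the complement of $S$ and $w_S:=x_{i_1}\cdots x_{i_r}$ for $S=\{i_1<\cdots<i_r\}$ (and $w_\emptyset=\mathbf 1$). The reduced coproduct $\tilde\Delta_0:\mathcal{H}_0\to\mathcal{H}_0\otimes\mathcal{H}_0$ is the linear map with $\tilde\Delta_0(w):=\Delta_0(w)-1\otimes w-w\otimes1$ for $w\in Y$. For $w,w'\in Y$, $w\otimes_{\mathrm{sym}}w':=w\otimes w'+w'\otimes w\in\mathcal{H}_0\otimes\mathcal{H}_0$. Juxtaposition of letters and words denotes concatenation. -}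

module Defs where

open import Algebra.Module.Bundles using (LeftModule)
import Algebra.Module.Morphism.Structures as Morphisms
import Algebra.Properties.AbelianGroup as AbelianGroupProperties
open import Data.Empty using (⊥)
open import Data.Fin using (Fin; toℕ)
open import Data.Fin.Subset using (Subset; inside; outside; ∁)
open import Data.Integer using (+_)
open import Data.List
  using (List; []; _∷_; [_]; _++_; _∷ʳ_; map; foldr; filter; length; replicate;
         take; drop; concatMap; zipWith; applyUpTo; cartesianProductWith; initLast; _∷ʳ′_)
open import Data.List.Properties using (∷ʳ-injectiveʳ)
open import Data.Nat as ℕ using (ℕ; zero; suc; _∸_)
open import Data.Nat.Combinatorics using (_C_)
open import Data.Nat.ListAction using (product)
open import Data.Product using (∃-syntax; _×_; _,_)
open import Data.Rational using (ℚ; 0ℚ; 1ℚ; _/_)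
import Data.Rational as ℚ
open import Data.Rational.Properties using (+-*-ring; *-comm)
open import Data.Sum using (_⊎_; inj₁; inj₂)
open import Data.Vec using (Vec; []; _∷_; toList; lookup)
open import Level using (0ℓ)
open import Relation.Binary.Core using (Rel)
open import Relation.Binary.PropositionalEquality as ≡ using (_≡_; refl)
open import Relation.Nullary using (¬_; yes; no; contradiction)
open import Relation.Nullary.Decidable using (_×-dec_)
open import Relation.Unary using (Pred; Decidable)
import Relation.Binary.Reasoning.Setoid as SetoidReasoning

------------------------------------------------------------------------
-- ℚ-vector spaces and linear maps

Vect : Set₁
Vect = LeftModule +-*-ring 0ℓ 0ℓ

∣_∣ᴹ : Vect → Set
∣ M ∣ᴹ = LeftModule.Carrierᴹ M

infix 4 equal
equal : (M : Vect) → Rel ∣ M ∣ᴹ 0ℓ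
equal M = LeftModule._≈ᴹ_ M
syntax equal M x y = x ≈[ M ] y

record LinearMap (M N : Vect) : Set where
  private
    module M = LeftModule M
    module N = LeftModule N
  open Morphisms.LeftModuleMorphisms M.rawLeftModule N.rawLeftModule
  field
    to    : ∣ M ∣ᴹ → ∣ N ∣ᴹ
    isHom : IsLeftModuleHomomorphism to
  open IsLeftModuleHomomorphism isHom public
    using (+ᴹ-homo; *ₗ-homo; 0ᴹ-homo; -ᴹ-homo) renaming (⟦⟧-cong to cong)
open LinearMap using (to) public

module _ (M : Vect) where
  open LeftModule M
  open AbelianGroupProperties +ᴹ-abelianGroup
  open SetoidReasoning ≈ᴹ-setoid

  +-interchange : ∀ a b c e → (a +ᴹ b) +ᴹ (c +ᴹ e) ≈[ M ] (a +ᴹ c) +ᴹ (b +ᴹ e)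
  +-interchange a b c e = begin
    (a +ᴹ b) +ᴹ (c +ᴹ e) ≈⟨ +ᴹ-assoc a b _ ⟩
    a +ᴹ (b +ᴹ (c +ᴹ e)) ≈⟨ +ᴹ-congˡ (≈ᴹ-sym (+ᴹ-assoc b c e)) ⟩
    a +ᴹ ((b +ᴹ c) +ᴹ e) ≈⟨ +ᴹ-congˡ (+ᴹ-congʳ (+ᴹ-comm b c)) ⟩
    a +ᴹ ((c +ᴹ b) +ᴹ e) ≈⟨ +ᴹ-congˡ (+ᴹ-assoc c b e) ⟩
    a +ᴹ (c +ᴹ (b +ᴹ e)) ≈⟨ ≈ᴹ-sym (+ᴹ-assoc a c _) ⟩
    (a +ᴹ c) +ᴹ (b +ᴹ e) ∎

  +-cancel : ∀ {x a b} → x ≈[ M ] a +ᴹ b → x +ᴹ -ᴹ b ≈[ M ] a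
  +-cancel {x} {a} {b} p = begin
    x +ᴹ -ᴹ b          ≈⟨ +ᴹ-congʳ p ⟩
    (a +ᴹ b) +ᴹ -ᴹ b   ≈⟨ +ᴹ-assoc a b _ ⟩
    a +ᴹ (b +ᴹ -ᴹ b)   ≈⟨ +ᴹ-congˡ (-ᴹ‿inverseʳ b) ⟩
    a +ᴹ 0ᴹ            ≈⟨ +ᴹ-identityʳ a ⟩
    a                  ∎

  +-split : ∀ x b → (x +ᴹ -ᴹ b) +ᴹ b ≈[ M ] x
  +-split x b = begin
    (x +ᴹ -ᴹ b) +ᴹ b ≈⟨ +ᴹ-assoc x _ b ⟩
    x +ᴹ (-ᴹ b +ᴹ b) ≈⟨ +ᴹ-congˡ (-ᴹ‿inverseˡ b) ⟩
    x +ᴹ 0ᴹ          ≈⟨ +ᴹ-identityʳ x ⟩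
    x                ∎

  neg-unique : ∀ x y → x +ᴹ y ≈[ M ] 0ᴹ → x ≈[ M ] -ᴹ y
  neg-unique = inverseˡ-unique

  neg-+ : ∀ x y → -ᴹ (x +ᴹ y) ≈[ M ] -ᴹ x +ᴹ -ᴹ y
  neg-+ x y = ≈ᴹ-sym (⁻¹-∙-comm x y)

  neg-scale : ∀ r x → -ᴹ (r *ₗ x) ≈[ M ] r *ₗ (-ᴹ x)
  neg-scale r x = ≈ᴹ-sym (neg-unique _ _ (begin
    r *ₗ (-ᴹ x) +ᴹ r *ₗ x ≈⟨ ≈ᴹ-sym (*ₗ-distribˡ r (-ᴹ x) x) ⟩
    r *ₗ (-ᴹ x +ᴹ x)      ≈⟨ *ₗ-congˡ (-ᴹ‿inverseˡ x) ⟩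
    r *ₗ 0ᴹ               ≈⟨ *ₗ-zeroʳ r ⟩
    0ᴹ                    ∎))

  neg-as-scale : ∀ x → (ℚ.- 1ℚ) *ₗ x ≈[ M ] -ᴹ x
  neg-as-scale x = neg-unique _ _ (begin
    (ℚ.- 1ℚ) *ₗ x +ᴹ x          ≈⟨ +ᴹ-congˡ (≈ᴹ-sym (*ₗ-identityˡ x)) ⟩
    (ℚ.- 1ℚ) *ₗ x +ᴹ 1ℚ *ₗ x    ≈⟨ ≈ᴹ-sym (*ₗ-distribʳ x _ _) ⟩
    ((ℚ.- 1ℚ) ℚ.+ 1ℚ) *ₗ x      ≈⟨ *ₗ-zeroˡ x ⟩
    0ᴹ                          ∎)

  scale-comm : ∀ r s x → r *ₗ (s *ₗ x) ≈[ M ] s *ₗ (r *ₗ x)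
  scale-comm r s x = begin
    r *ₗ (s *ₗ x)  ≈⟨ ≈ᴹ-sym (*ₗ-assoc r s x) ⟩
    (r ℚ.* s) *ₗ x ≡⟨ ≡.cong (_*ₗ x) (*-comm r s) ⟩
    (s ℚ.* r) *ₗ x ≈⟨ *ₗ-assoc s r x ⟩
    s *ₗ (r *ₗ x)  ∎

  ∑ : {I : Set} → List I → (I → ∣ M ∣ᴹ) → ∣ M ∣ᴹ
  ∑ is f = foldr (λ i s → f i +ᴹ s) 0ᴹ is

module _ {M N : Vect} where
  private
    module M = LeftModule M
    module N = LeftModule N
  open SetoidReasoning N.≈ᴹ-setoid

  linearMap : (f : ∣ M ∣ᴹ → ∣ N ∣ᴹ) →
              (∀ {x y} → x ≈[ M ] y → f x ≈[ N ] f y) →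
              (∀ x y → f (x M.+ᴹ y) ≈[ N ] f x N.+ᴹ f y) →
              (∀ r x → f (r M.*ₗ x) ≈[ N ] r N.*ₗ f x) →
              LinearMap M N
  LinearMap.to (linearMap f f-cong f-+ f-*) = f
  LinearMap.isHom (linearMap f f-cong f-+ f-*) = record
    { +ᴹ-isGroupHomomorphism = record
      { isMonoidHomomorphism = record
        { isMagmaHomomorphism = record
          { isRelHomomorphism = record { cong = f-cong }
          ; homo              = f-+
          }
        ; ε-homo = f-0
        }
      ; ⁻¹-homo = λ x → neg-unique N _ _ (begin
          f (M.-ᴹ x) N.+ᴹ f x ≈⟨ N.≈ᴹ-sym (f-+ _ _) ⟩
          f (M.-ᴹ x M.+ᴹ x)   ≈⟨ f-cong (M.-ᴹ‿inverseˡ x) ⟩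
          f M.0ᴹ              ≈⟨ f-0 ⟩
          N.0ᴹ                ∎)
      }
    ; *ₗ-homo = f-*
    }
    where
    f-0 : f M.0ᴹ ≈[ N ] N.0ᴹ
    f-0 = begin
      f M.0ᴹ               ≈⟨ f-cong (M.≈ᴹ-sym (M.*ₗ-zeroˡ M.0ᴹ)) ⟩
      f (0ℚ M.*ₗ M.0ᴹ)     ≈⟨ f-* 0ℚ M.0ᴹ ⟩
      0ℚ N.*ₗ f M.0ᴹ       ≈⟨ N.*ₗ-zeroˡ _ ⟩
      N.0ᴹ                 ∎

idˡ : ∀ {M} → LinearMap M M
idˡ {M} = linearMap (λ x → x) (λ p → p) (λ _ _ → ≈ᴹ-refl) (λ _ _ → ≈ᴹ-refl)
  where open LeftModule M

infixr 9 _∘ˡ_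
_∘ˡ_ : ∀ {M N P} → LinearMap N P → LinearMap M N → LinearMap M P
_∘ˡ_ {M} {N} {P} g f = linearMap
  (λ x → to g (to f x))
  (λ p → G.cong (F.cong p))
  (λ x y → ≈ᴹ-trans (G.cong (F.+ᴹ-homo x y)) (G.+ᴹ-homo _ _))
  (λ r x → ≈ᴹ-trans (G.cong (F.*ₗ-homo r x)) (G.*ₗ-homo _ _))
  where
  open LeftModule P
  module F = LinearMap f
  module G = LinearMap g

module _ (M N : Vect) where
  open LeftModule N

  Hom : Vect
  LeftModule.Carrierᴹ Hom = LinearMap M N
  LeftModule._≈ᴹ_ Hom = λ f g → ∀ x → to f x ≈ᴹ to g x
  LeftModule._+ᴹ_ Hom = λ f g → linearMap
      (λ x → to f x +ᴹ to g x)
      (λ p → +ᴹ-cong (LinearMap.cong f p) (LinearMap.cong g p))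
      (λ x y → ≈ᴹ-trans (+ᴹ-cong (LinearMap.+ᴹ-homo f x y) (LinearMap.+ᴹ-homo g x y))
                        (+-interchange N _ _ _ _))
      (λ r x → ≈ᴹ-trans (+ᴹ-cong (LinearMap.*ₗ-homo f r x) (LinearMap.*ₗ-homo g r x))
                        (≈ᴹ-sym (*ₗ-distribˡ r _ _)))
  LeftModule._*ₗ_ Hom = λ r f → linearMap
      (λ x → r *ₗ to f x)
      (λ p → *ₗ-congˡ (LinearMap.cong f p))
      (λ x y → ≈ᴹ-trans (*ₗ-congˡ (LinearMap.+ᴹ-homo f x y)) (*ₗ-distribˡ r _ _))
      (λ s x → ≈ᴹ-trans (*ₗ-congˡ (LinearMap.*ₗ-homo f s x)) (scale-comm N r s _))
  LeftModule.0ᴹ Hom = linearMap (λ _ → 0ᴹ) (λ _ → ≈ᴹ-refl)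
      (λ _ _ → ≈ᴹ-sym (+ᴹ-identityˡ _)) (λ r _ → ≈ᴹ-sym (*ₗ-zeroʳ r))
  LeftModule.-ᴹ_ Hom = λ f → linearMap
      (λ x → -ᴹ to f x)
      (λ p → -ᴹ‿cong (LinearMap.cong f p))
      (λ x y → ≈ᴹ-trans (-ᴹ‿cong (LinearMap.+ᴹ-homo f x y)) (neg-+ N _ _))
      (λ r x → ≈ᴹ-trans (-ᴹ‿cong (LinearMap.*ₗ-homo f r x)) (neg-scale N r _))
  LeftModule.isLeftModule Hom = record
    { isLeftSemimodule = record
      { +ᴹ-isCommutativeMonoid = record
        { isMonoid = record
          { isSemigroup = record
            { isMagma = record
              { isEquivalence = record
                { refl  = λ _ → ≈ᴹ-refl
                ; sym   = λ p x → ≈ᴹ-sym (p x)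
                ; trans = λ p q x → ≈ᴹ-trans (p x) (q x)
                }
              ; ∙-cong = λ p q x → +ᴹ-cong (p x) (q x)
              }
            ; assoc = λ _ _ _ _ → +ᴹ-assoc _ _ _
            }
          ; identity = (λ _ _ → +ᴹ-identityˡ _) , (λ _ _ → +ᴹ-identityʳ _)
          }
        ; comm = λ _ _ _ → +ᴹ-comm _ _
        }
      ; isPreleftSemimodule = record
        { *ₗ-cong      = λ p q x → *ₗ-cong p (q x)
        ; *ₗ-zeroˡ     = λ _ _ → *ₗ-zeroˡ _
        ; *ₗ-distribʳ  = λ _ _ _ _ → *ₗ-distribʳ _ _ _
        ; *ₗ-identityˡ = λ _ _ → *ₗ-identityˡ _
        ; *ₗ-assoc     = λ _ _ _ _ → *ₗ-assoc _ _ _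
        ; *ₗ-zeroʳ     = λ _ _ → *ₗ-zeroʳ _
        ; *ₗ-distribˡ  = λ _ _ _ _ → *ₗ-distribˡ _ _ _
        }
      }
    ; -ᴹ‿cong    = λ p x → -ᴹ‿cong (p x)
    ; -ᴹ‿inverse = (λ _ _ → -ᴹ‿inverseˡ _) , (λ _ _ → -ᴹ‿inverseʳ _)
    }

flipˡ : ∀ {M N P} → LinearMap M (Hom N P) → LinearMap N (Hom M P)
flipˡ {M} {N} {P} f = linearMap
  (λ y → linearMap (λ x → to (to f x) y)
    (λ p → F.cong p y) (λ a b → F.+ᴹ-homo a b y) (λ r a → F.*ₗ-homo r a y))
  (λ p x → LinearMap.cong (to f x) p)
  (λ a b x → LinearMap.+ᴹ-homo (to f x) a b)
  (λ r a x → LinearMap.*ₗ-homo (to f x) r a)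
  where module F = LinearMap f

postcompose : ∀ {M N P} → LinearMap N P → LinearMap (Hom M N) (Hom M P)
postcompose g = linearMap (g ∘ˡ_) (λ p x → G.cong (p x))
  (λ _ _ _ → G.+ᴹ-homo _ _) (λ _ _ _ → G.*ₗ-homo _ _)
  where module G = LinearMap g

precompose : ∀ {M N P} → LinearMap M N → LinearMap (Hom N P) (Hom M P)
precompose {P = P} g = linearMap (_∘ˡ g) (λ p x → p _)
  (λ _ _ _ → ≈ᴹ-refl) (λ _ _ _ → ≈ᴹ-refl)
  where open LeftModule P

------------------------------------------------------------------------
-- Vector spaces given by generators and relations: formal linear combinations
-- modulo the least congruence containing the relations and the module axioms.

data Term (G : Set) : Set where
  gen : G → Term G
  0ₜ  : Term G
  _+ₜ_ : Term G → Term G → Term G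
  _·ₜ_ : ℚ → Term G → Term G

data Congruence {G : Set} (_~_ : Rel (Term G) 0ℓ) : Rel (Term G) 0ℓ where
  relation    : ∀ {s t} → s ~ t → Congruence _~_ s t
  reflexive   : ∀ {s} → Congruence _~_ s s
  symmetric   : ∀ {s t} → Congruence _~_ s t → Congruence _~_ t s
  transitive  : ∀ {s t u} → Congruence _~_ s t → Congruence _~_ t u → Congruence _~_ s u
  +-cong      : ∀ {s s′ t t′} → Congruence _~_ s s′ → Congruence _~_ t t′ →
                Congruence _~_ (s +ₜ t) (s′ +ₜ t′)
  ·-cong      : ∀ r {s s′} → Congruence _~_ s s′ → Congruence _~_ (r ·ₜ s) (r ·ₜ s′)
  +-assoc     : ∀ s t u → Congruence _~_ ((s +ₜ t) +ₜ u) (s +ₜ (t +ₜ u))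
  +-comm      : ∀ s t → Congruence _~_ (s +ₜ t) (t +ₜ s)
  +-identityˡ : ∀ s → Congruence _~_ (0ₜ +ₜ s) s
  ·-zeroˡ     : ∀ s → Congruence _~_ (0ℚ ·ₜ s) 0ₜ
  ·-identityˡ : ∀ s → Congruence _~_ (1ℚ ·ₜ s) s
  ·-assoc     : ∀ q r s → Congruence _~_ ((q ℚ.* r) ·ₜ s) (q ·ₜ (r ·ₜ s))
  ·-distribʳ  : ∀ s q r → Congruence _~_ ((q ℚ.+ r) ·ₜ s) ((q ·ₜ s) +ₜ (r ·ₜ s))
  ·-distribˡ  : ∀ r s t → Congruence _~_ (r ·ₜ (s +ₜ t)) ((r ·ₜ s) +ₜ (r ·ₜ t))

Presented : (G : Set) → Rel (Term G) 0ℓ → Vect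
LeftModule.Carrierᴹ (Presented G _~_) = Term G
LeftModule._≈ᴹ_ (Presented G _~_) = Congruence _~_
LeftModule._+ᴹ_ (Presented G _~_) = _+ₜ_
LeftModule._*ₗ_ (Presented G _~_) = _·ₜ_
LeftModule.0ᴹ (Presented G _~_) = 0ₜ
LeftModule.-ᴹ_ (Presented G _~_) = (ℚ.- 1ℚ) ·ₜ_
LeftModule.isLeftModule (Presented G _~_) = record
  { isLeftSemimodule = record
    { +ᴹ-isCommutativeMonoid = record
      { isMonoid = record
        { isSemigroup = record
          { isMagma = record
            { isEquivalence = record
              { refl = reflexive ; sym = symmetric ; trans = transitive }
            ; ∙-cong = +-cong
            }
          ; assoc = +-assoc
          }
        ; identity = +-identityˡ , λ s → transitive (+-comm s 0ₜ) (+-identityˡ s)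
        }
      ; comm = +-comm
      }
    ; isPreleftSemimodule = record
      { *ₗ-cong      = λ { {r} refl p → ·-cong r p }
      ; *ₗ-zeroˡ     = ·-zeroˡ
      ; *ₗ-distribʳ  = ·-distribʳ
      ; *ₗ-identityˡ = ·-identityˡ
      ; *ₗ-assoc     = ·-assoc
      ; *ₗ-zeroʳ     = ·-zeroʳ
      ; *ₗ-distribˡ  = ·-distribˡ
      }
    }
  ; -ᴹ‿cong    = ·-cong _
  ; -ᴹ‿inverse = inverseˡ , λ s → transitive (+-comm _ _) (inverseˡ s)
  }
  where
  _≈_ : Rel (Term G) 0ℓ
  _≈_ = Congruence _~_

  ·-zeroʳ : ∀ r → (r ·ₜ 0ₜ) ≈ 0ₜ
  ·-zeroʳ r = transitive (·-cong r (symmetric (·-zeroˡ 0ₜ)))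
    (transitive (symmetric (·-assoc r 0ℚ 0ₜ))
    (transitive (≡.subst (λ q → ((r ℚ.* 0ℚ) ·ₜ 0ₜ) ≈ (q ·ₜ 0ₜ)) (*-comm r 0ℚ) reflexive)
    (transitive (·-assoc 0ℚ r 0ₜ) (·-zeroˡ _))))

  inverseˡ : ∀ s → (((ℚ.- 1ℚ) ·ₜ s) +ₜ s) ≈ 0ₜ
  inverseˡ s = transitive (+-cong reflexive (symmetric (·-identityˡ s)))
    (transitive (symmetric (·-distribʳ s _ _)) (·-zeroˡ s))

extend : ∀ {G} (N : Vect) → (G → ∣ N ∣ᴹ) → Term G → ∣ N ∣ᴹ
extend N f (gen g)  = f g
extend N f 0ₜ       = LeftModule.0ᴹ N
extend N f (s +ₜ t) = LeftModule._+ᴹ_ N (extend N f s) (extend N f t)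
extend N f (r ·ₜ s) = LeftModule._*ₗ_ N r (extend N f s)

presentedMap : ∀ {G} {_~_ : Rel (Term G) 0ℓ} {N : Vect} (f : G → ∣ N ∣ᴹ) →
               (∀ {s t} → s ~ t → extend N f s ≈[ N ] extend N f t) →
               LinearMap (Presented G _~_) N
presentedMap {G} {_~_} {N} f f-resp =
  linearMap (extend N f) resp (λ _ _ → ≈ᴹ-refl) (λ _ _ → ≈ᴹ-refl)
  where
  open LeftModule N
  resp : ∀ {s t} → Congruence _~_ s t → extend N f s ≈[ N ] extend N f t
  resp (relation p)       = f-resp p
  resp reflexive          = ≈ᴹ-refl
  resp (symmetric p)      = ≈ᴹ-sym (resp p)
  resp (transitive p q)   = ≈ᴹ-trans (resp p) (resp q)
  resp (+-cong p q)       = +ᴹ-cong (resp p) (resp q)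
  resp (·-cong r p)       = *ₗ-congˡ (resp p)
  resp (+-assoc s t u)    = +ᴹ-assoc _ _ _
  resp (+-comm s t)       = +ᴹ-comm _ _
  resp (+-identityˡ s)    = +ᴹ-identityˡ _
  resp (·-zeroˡ s)        = *ₗ-zeroˡ _
  resp (·-identityˡ s)    = *ₗ-identityˡ _
  resp (·-assoc q r s)    = *ₗ-assoc _ _ _
  resp (·-distribʳ s q r) = *ₗ-distribʳ _ _ _
  resp (·-distribˡ r s t) = *ₗ-distribˡ _ _ _

presented-ext : ∀ {G} {_~_ : Rel (Term G) 0ℓ} {N : Vect}
                (f g : LinearMap (Presented G _~_) N) →
                (∀ x → to f (gen x) ≈[ N ] to g (gen x)) →
                ∀ t → to f t ≈[ N ] to g t
presented-ext {N = N} f g p = go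
  where
  open LeftModule N
  module F = LinearMap f
  module G = LinearMap g
  go : ∀ t → to f t ≈[ N ] to g t
  go (gen x)  = p x
  go 0ₜ       = ≈ᴹ-trans F.0ᴹ-homo (≈ᴹ-sym G.0ᴹ-homo)
  go (s +ₜ t) = ≈ᴹ-trans (F.+ᴹ-homo s t)
    (≈ᴹ-trans (+ᴹ-cong (go s) (go t)) (≈ᴹ-sym (G.+ᴹ-homo s t)))
  go (r ·ₜ s) = ≈ᴹ-trans (F.*ₗ-homo r s)
    (≈ᴹ-trans (*ₗ-congˡ (go s)) (≈ᴹ-sym (G.*ₗ-homo r s)))

Free : Set → Vect
Free X = Presented X (λ _ _ → ⊥)

freeMap : ∀ {X} {N : Vect} → (X → ∣ N ∣ᴹ) → LinearMap (Free X) N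
freeMap f = presentedMap f (λ ())

module _ (M N : Vect) where
  private
    module M = LeftModule M
    module N = LeftModule N

  data Bilinear : Rel (Term (∣ M ∣ᴹ × ∣ N ∣ᴹ)) 0ℓ where
    ⊗-cong : ∀ {m m′ n n′} → m ≈[ M ] m′ → n ≈[ N ] n′ →
             Bilinear (gen (m , n)) (gen (m′ , n′))
    ⊗-+ˡ : ∀ m m′ n → Bilinear (gen (m M.+ᴹ m′ , n)) (gen (m , n) +ₜ gen (m′ , n))
    ⊗-+ʳ : ∀ m n n′ → Bilinear (gen (m , n N.+ᴹ n′)) (gen (m , n) +ₜ gen (m , n′))
    ⊗-·ˡ : ∀ r m n → Bilinear (gen (r M.*ₗ m , n)) (r ·ₜ gen (m , n))
    ⊗-·ʳ : ∀ r m n → Bilinear (gen (m , r N.*ₗ n)) (r ·ₜ gen (m , n))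

infixr 7 _⊗ᴹ_
_⊗ᴹ_ : Vect → Vect → Vect
M ⊗ᴹ N = Presented (∣ M ∣ᴹ × ∣ N ∣ᴹ) (Bilinear M N)

tensor : ∀ {M N} → LinearMap M (Hom N (M ⊗ᴹ N))
tensor {M} {N} = linearMap
  (λ m → linearMap (λ n → gen (m , n))
    (λ p → relation (⊗-cong (LeftModule.≈ᴹ-refl M) p))
    (λ n n′ → relation (⊗-+ʳ m n n′)) (λ r n → relation (⊗-·ʳ r m n)))
  (λ p n → relation (⊗-cong p (LeftModule.≈ᴹ-refl N)))
  (λ m m′ n → relation (⊗-+ˡ m m′ n)) (λ r m n → relation (⊗-·ˡ r m n))

uncurryˡ : ∀ {M N P} → LinearMap M (Hom N P) → LinearMap (M ⊗ᴹ N) P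
uncurryˡ {M} {N} {P} f = presentedMap (λ (m , n) → to (to f m) n) resp
  where
  open LeftModule P
  module F = LinearMap f
  module F′ m = LinearMap (to f m)
  resp : ∀ {s t} → Bilinear M N s t →
         extend P (λ (m , n) → to (to f m) n) s ≈[ P ] extend P (λ (m , n) → to (to f m) n) t
  resp (⊗-cong p q)   = ≈ᴹ-trans (F.cong p _) (F′.cong _ q)
  resp (⊗-+ˡ m m′ n)  = F.+ᴹ-homo m m′ n
  resp (⊗-+ʳ m n n′)  = F′.+ᴹ-homo m n n′
  resp (⊗-·ˡ r m n)   = F.*ₗ-homo r m n
  resp (⊗-·ʳ r m n)   = F′.*ₗ-homo m r n

------------------------------------------------------------------------
-- Subspaces and quotients

module _ (M : Vect) where
  open LeftModule M

  record IsSubspace (P : Pred ∣ M ∣ᴹ 0ℓ) : Set where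
    field
      0-closed : P 0ᴹ
      +-closed : ∀ {x y} → P x → P y → P (x +ᴹ y)
      ·-closed : ∀ r {x} → P x → P (r *ₗ x)

  data Span (P : Pred ∣ M ∣ᴹ 0ℓ) : Pred ∣ M ∣ᴹ 0ℓ where
    span-gen  : ∀ {x} → P x → Span P x
    span-0    : Span P 0ᴹ
    span-+    : ∀ {x y} → Span P x → Span P y → Span P (x +ᴹ y)
    span-·    : ∀ r {x} → Span P x → Span P (r *ₗ x)
    span-resp : ∀ {x y} → x ≈[ M ] y → Span P x → Span P y

  Sum : Pred ∣ M ∣ᴹ 0ℓ → Pred ∣ M ∣ᴹ 0ℓ → Pred ∣ M ∣ᴹ 0ℓ
  Sum P Q x = ∃[ p ] ∃[ q ] P p × Q q × x ≈[ M ] p +ᴹ q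

module _ (M : Vect) {P : Pred ∣ M ∣ᴹ 0ℓ} (P-sub : IsSubspace M P) where
  open LeftModule M
  open IsSubspace P-sub

  private
    -- x ∈ y + P
    _∼_ : Rel ∣ M ∣ᴹ 0ℓ
    x ∼ y = ∃[ p ] P p × x ≈[ M ] y +ᴹ p

    lift≈ : ∀ {x y} → x ≈[ M ] y → x ∼ y
    lift≈ e = 0ᴹ , 0-closed , ≈ᴹ-trans e (≈ᴹ-sym (+ᴹ-identityʳ _))

    ∼-sym : ∀ {x y} → x ∼ y → y ∼ x
    ∼-sym {x} {y} (p , Pp , e) = (ℚ.- 1ℚ) *ₗ p , ·-closed _ Pp ,
      ≈ᴹ-sym (≈ᴹ-trans (+ᴹ-congˡ (neg-as-scale M p)) (+-cancel M e))

    ∼-trans : ∀ {x y z} → x ∼ y → y ∼ z → x ∼ z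
    ∼-trans (p , Pp , e) (q , Pq , e′) = q +ᴹ p , +-closed Pq Pp ,
      ≈ᴹ-trans e (≈ᴹ-trans (+ᴹ-congʳ e′) (+ᴹ-assoc _ _ _))

    ∼-+ : ∀ {x x′ y y′} → x ∼ x′ → y ∼ y′ → (x +ᴹ y) ∼ (x′ +ᴹ y′)
    ∼-+ (p , Pp , e) (q , Pq , e′) = p +ᴹ q , +-closed Pp Pq ,
      ≈ᴹ-trans (+ᴹ-cong e e′) (+-interchange M _ _ _ _)

    ∼-· : ∀ r {x x′} → x ∼ x′ → (r *ₗ x) ∼ (r *ₗ x′)
    ∼-· r (p , Pp , e) = r *ₗ p , ·-closed r Pp ,
      ≈ᴹ-trans (*ₗ-congˡ e) (*ₗ-distribˡ r _ _)

    ∼-neg : ∀ {x x′} → x ∼ x′ → (-ᴹ x) ∼ (-ᴹ x′)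
    ∼-neg e = ∼-trans (lift≈ (≈ᴹ-sym (neg-as-scale M _)))
      (∼-trans (∼-· _ e) (lift≈ (neg-as-scale M _)))

  Quotient : Vect
  LeftModule.Carrierᴹ Quotient = Carrierᴹ
  LeftModule._≈ᴹ_ Quotient = _∼_
  LeftModule._+ᴹ_ Quotient = _+ᴹ_
  LeftModule._*ₗ_ Quotient = _*ₗ_
  LeftModule.0ᴹ Quotient = 0ᴹ
  LeftModule.-ᴹ_ Quotient = -ᴹ_
  LeftModule.isLeftModule Quotient = record
    { isLeftSemimodule = record
      { +ᴹ-isCommutativeMonoid = record
        { isMonoid = record
          { isSemigroup = record
            { isMagma = record
              { isEquivalence = record
                { refl = lift≈ ≈ᴹ-refl ; sym = ∼-sym ; trans = ∼-trans }
              ; ∙-cong = ∼-+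
              }
            ; assoc = λ x y z → lift≈ (+ᴹ-assoc x y z)
            }
          ; identity = (λ x → lift≈ (+ᴹ-identityˡ x)) , (λ x → lift≈ (+ᴹ-identityʳ x))
          }
        ; comm = λ x y → lift≈ (+ᴹ-comm x y)
        }
      ; isPreleftSemimodule = record
        { *ₗ-cong      = λ { {r} refl e → ∼-· r e }
        ; *ₗ-zeroˡ     = λ x → lift≈ (*ₗ-zeroˡ x)
        ; *ₗ-distribʳ  = λ x q r → lift≈ (*ₗ-distribʳ x q r)
        ; *ₗ-identityˡ = λ x → lift≈ (*ₗ-identityˡ x)
        ; *ₗ-assoc     = λ q r x → lift≈ (*ₗ-assoc q r x)
        ; *ₗ-zeroʳ     = λ r → lift≈ (*ₗ-zeroʳ r)
        ; *ₗ-distribˡ  = λ r x y → lift≈ (*ₗ-distribˡ r x y)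
        }
      }
    ; -ᴹ‿cong    = ∼-neg
    ; -ᴹ‿inverse = (λ x → lift≈ (-ᴹ‿inverseˡ x)) , (λ x → lift≈ (-ᴹ‿inverseʳ x))
    }

  project : LinearMap M Quotient
  project = linearMap (λ x → x) lift≈ (λ _ _ → lift≈ ≈ᴹ-refl) (λ _ _ → lift≈ ≈ᴹ-refl)

  vanish : ∀ {x} → P x → x ≈[ Quotient ] 0ᴹ
  vanish {x} Px = x , Px , ≈ᴹ-sym (+ᴹ-identityˡ x)

  quotientMap : ∀ {N} (f : LinearMap M N) →
                (∀ {x} → P x → to f x ≈[ N ] LeftModule.0ᴹ N) →
                LinearMap Quotient N
  quotientMap {N} f f-vanish = linearMap (to f)
    (λ (p , Pp , e) → N.≈ᴹ-trans (F.cong e) (N.≈ᴹ-trans (F.+ᴹ-homo _ _)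
      (N.≈ᴹ-trans (N.+ᴹ-congˡ (f-vanish Pp)) (N.+ᴹ-identityʳ _))))
    F.+ᴹ-homo F.*ₗ-homo
    where
    module N = LeftModule N
    module F = LinearMap f

------------------------------------------------------------------------
-- The algebra (ℚ⟨L⟩, ⧢) and the quotient H₀

data Letter : Set where
  d y : Letter

Word : Set
Word = List Letter

ℚ⟨L⟩ : Vect
ℚ⟨L⟩ = Free Word

private
  module A = LeftModule ℚ⟨L⟩

infixr 8 _▹_
prepend : Letter → LinearMap ℚ⟨L⟩ ℚ⟨L⟩
prepend x = freeMap (λ w → gen (x ∷ w))

_▹_ : Letter → ∣ ℚ⟨L⟩ ∣ᴹ → ∣ ℚ⟨L⟩ ∣ᴹ
x ▹ a = to (prepend x) a

infixl 7 _⧢ʷ_ _⧢_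
-- The clauses chosen to make the recursion deterministic imply the remaining
-- ones, w ⧢ 𝟏 = w and u ⧢ yv = y(u ⧢ v) for all u: see ⧢-1 and ⧢-y below.
_⧢ʷ_ : Word → Word → ∣ ℚ⟨L⟩ ∣ᴹ
[]      ⧢ʷ v       = gen v
(y ∷ u) ⧢ʷ v       = y ▹ (u ⧢ʷ v)
(d ∷ u) ⧢ʷ []      = gen (d ∷ u)
(d ∷ u) ⧢ʷ (y ∷ v) = y ▹ ((d ∷ u) ⧢ʷ v)
(d ∷ u) ⧢ʷ (d ∷ v) = d ▹ (u ⧢ʷ (d ∷ v)) A.+ᴹ A.-ᴹ (u ⧢ʷ (d ∷ d ∷ v))

shuffle : LinearMap ℚ⟨L⟩ (Hom ℚ⟨L⟩ ℚ⟨L⟩)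
shuffle = freeMap (λ u → freeMap (λ v → u ⧢ʷ v))

_⧢_ : ∣ ℚ⟨L⟩ ∣ᴹ → ∣ ℚ⟨L⟩ ∣ᴹ → ∣ ℚ⟨L⟩ ∣ᴹ
a ⧢ b = to (to shuffle a) b

data Ideal (P : Pred ∣ ℚ⟨L⟩ ∣ᴹ 0ℓ) : Pred ∣ ℚ⟨L⟩ ∣ᴹ 0ℓ where
  ideal-gen  : ∀ {x} → P x → Ideal P x
  ideal-0    : Ideal P A.0ᴹ
  ideal-+    : ∀ {x x′} → Ideal P x → Ideal P x′ → Ideal P (x A.+ᴹ x′)
  ideal-·    : ∀ r {x} → Ideal P x → Ideal P (r A.*ₗ x)
  ideal-⧢ˡ   : ∀ a {x} → Ideal P x → Ideal P (a ⧢ x)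
  ideal-⧢ʳ   : ∀ a {x} → Ideal P x → Ideal P (x ⧢ a)
  ideal-resp : ∀ {x x′} → x ≈[ ℚ⟨L⟩ ] x′ → Ideal P x → Ideal P x′

data EndsInD : Pred ∣ ℚ⟨L⟩ ∣ᴹ 0ℓ where
  ends-in-d : ∀ w → EndsInD (gen (w ∷ʳ d))

T₋ : Pred ∣ ℚ⟨L⟩ ∣ᴹ 0ℓ
T₋ = Span ℚ⟨L⟩ EndsInD

d^_▹_ : ℕ → ∣ ℚ⟨L⟩ ∣ᴹ → ∣ ℚ⟨L⟩ ∣ᴹ
d^ zero  ▹ a = a
d^ suc k ▹ a = d ▹ (d^ k ▹ a)

data LeibnizDefect : Pred ∣ ℚ⟨L⟩ ∣ᴹ 0ℓ where
  leibniz-defect : ∀ k (u v : Word) → LeibnizDefect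
    (d^ k ▹ ((d ▹ (gen u ⧢ gen v) A.+ᴹ A.-ᴹ (gen (d ∷ u) ⧢ gen v))
             A.+ᴹ A.-ᴹ (gen u ⧢ gen (d ∷ v))))

L₋ : Pred ∣ ℚ⟨L⟩ ∣ᴹ 0ℓ
L₋ = Ideal LeibnizDefect

S₋ : Pred ∣ ℚ⟨L⟩ ∣ᴹ 0ℓ
S₋ = Sum ℚ⟨L⟩ T₋ L₋

L₋-isSubspace : IsSubspace ℚ⟨L⟩ L₋
L₋-isSubspace = record
  { 0-closed = ideal-0 ; +-closed = ideal-+ ; ·-closed = λ r → ideal-· r }

S₋-isSubspace : IsSubspace ℚ⟨L⟩ S₋
S₋-isSubspace = record
  { 0-closed = 0ₜ , 0ₜ , span-0 , ideal-0 , A.≈ᴹ-sym (A.+ᴹ-identityˡ _)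
  ; +-closed = λ (_ , _ , t , l , e) (_ , _ , t′ , l′ , e′) →
      _ , _ , span-+ t t′ , ideal-+ l l′ ,
      A.≈ᴹ-trans (A.+ᴹ-cong e e′) (+-interchange ℚ⟨L⟩ _ _ _ _)
  ; ·-closed = λ r (_ , _ , t , l , e) →
      _ , _ , span-· r t , ideal-· r l ,
      A.≈ᴹ-trans (A.*ₗ-congˡ e) (A.*ₗ-distribˡ r _ _)
  }

H₀ : Vect
H₀ = Quotient ℚ⟨L⟩ S₋-isSubspace

private
  module H = LeftModule H₀

π : LinearMap ℚ⟨L⟩ H₀
π = project ℚ⟨L⟩ S₋-isSubspace

H₀⊗H₀ : Vect
H₀⊗H₀ = H₀ ⊗ᴹ H₀

private
  module TT = LeftModule H₀⊗H₀

infix 8 _⊗_ _⊗ʷ_ _⊗sym_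
_⊗_ : ∣ H₀ ∣ᴹ → ∣ H₀ ∣ᴹ → ∣ H₀⊗H₀ ∣ᴹ
a ⊗ b = to (to (tensor {H₀} {H₀}) a) b

word : Word → ∣ H₀ ∣ᴹ
word w = to π (gen w)

𝟏 : ∣ H₀ ∣ᴹ
𝟏 = word []

_⊗ʷ_ _⊗sym_ : Word → Word → ∣ H₀⊗H₀ ∣ᴹ
u ⊗ʷ v = word u ⊗ word v
u ⊗sym v = u ⊗ʷ v TT.+ᴹ v ⊗ʷ u

------------------------------------------------------------------------
-- The defining formula of the coproduct

Y : Pred Word 0ℓ
Y w = w ≡ [] ⊎ ∃[ u ] w ≡ u ∷ʳ y

Y? : Decidable Y
Y? w with initLast w
... | []      = yes (inj₁ refl)
... | u ∷ʳ′ y = yes (inj₂ (u , refl))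
... | u ∷ʳ′ d = no (λ
  { (inj₁ e)        → nonempty u e
  ; (inj₂ (u′ , e)) → contradiction (∷ʳ-injectiveʳ u u′ e) (λ ()) })
  where
  nonempty : ∀ u → ¬ (u ∷ʳ d ≡ [])
  nonempty []      ()
  nonempty (_ ∷ _) ()

subsets : ∀ n → List (Subset n)
subsets zero    = [ [] ]
subsets (suc n) = map (inside ∷_) (subsets n) ++ map (outside ∷_) (subsets n)

infix 9 _‖_
_‖_ : (w : Word) → Subset (length w) → Word
[]      ‖ []            = []
(x ∷ w) ‖ (inside ∷ S)  = x ∷ w ‖ S
(x ∷ w) ‖ (outside ∷ S) = w ‖ S

Admissible : (w : Word) → Pred (Subset (length w)) 0ℓ
Admissible w S = Y (w ‖ S) × Y (w ‖ ∁ S)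

admissible? : ∀ w → Decidable (Admissible w)
admissible? w S = Y? (w ‖ S) ×-dec Y? (w ‖ ∁ S)

-- The formula is meant for words in Y. If w ends in d then so does w_S or its
-- complement, hence no S is admissible and Δ₀ʷ w = 0; this is the value forced
-- by linearity, as the class of w in H₀ is zero.
Δ₀ʷ : Word → ∣ H₀⊗H₀ ∣ᴹ
Δ₀ʷ w = ∑ H₀⊗H₀ (filter (admissible? w) (subsets (length w)))
                (λ S → w ‖ S ⊗ʷ w ‖ ∁ S)

------------------------------------------------------------------------
-- The formula descends to H₀. Modulo S₋ the map d ▹_ is a derivation and S₋ is
-- an ideal; Δ₀ʷ agrees with the coproduct for which d and y are primitive with
-- respect to concatenation, and the latter is multiplicative for ⧢.

y-⧢ : ∀ a b → (y ▹ a) ⧢ b ≈[ ℚ⟨L⟩ ] y ▹ (a ⧢ b)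
y-⧢ = presented-ext {N = Hom ℚ⟨L⟩ ℚ⟨L⟩}
  (shuffle ∘ˡ prepend y) (postcompose (prepend y) ∘ˡ shuffle)
  (λ u → presented-ext (to shuffle (gen (y ∷ u))) (prepend y ∘ˡ to shuffle (gen u))
    (λ v → A.≈ᴹ-refl))

⧢-y : ∀ a b → a ⧢ (y ▹ b) ≈[ ℚ⟨L⟩ ] y ▹ (a ⧢ b)
⧢-y = presented-ext {N = Hom ℚ⟨L⟩ ℚ⟨L⟩}
  (precompose (prepend y) ∘ˡ shuffle) (postcompose (prepend y) ∘ˡ shuffle)
  (λ u → presented-ext (to shuffle (gen u) ∘ˡ prepend y) (prepend y ∘ˡ to shuffle (gen u))
    (go u))
  where
  go : ∀ u v → u ⧢ʷ (y ∷ v) ≈[ ℚ⟨L⟩ ] y ▹ (u ⧢ʷ v)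
  go []      v = A.≈ᴹ-refl
  go (y ∷ u) v = LinearMap.cong (prepend y) (go u v)
  go (d ∷ u) v = A.≈ᴹ-refl

1-⧢ : ∀ b → gen [] ⧢ b ≈[ ℚ⟨L⟩ ] b
1-⧢ = presented-ext (to shuffle (gen [])) idˡ (λ v → A.≈ᴹ-refl)

⧢-1 : ∀ a → a ⧢ gen [] ≈[ ℚ⟨L⟩ ] a
⧢-1 = presented-ext (to (flipˡ shuffle) (gen [])) idˡ go
  where
  go : ∀ u → u ⧢ʷ [] ≈[ ℚ⟨L⟩ ] gen u
  go []      = A.≈ᴹ-refl
  go (y ∷ u) = LinearMap.cong (prepend y) (go u)
  go (d ∷ u) = A.≈ᴹ-refl

A/L₋ : Vect
A/L₋ = Quotient ℚ⟨L⟩ L₋-isSubspace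

-- x = ((x - a) - b) + a + b
regroup : ∀ x a b → x ≈[ ℚ⟨L⟩ ] (a A.+ᴹ b) A.+ᴹ ((x A.+ᴹ A.-ᴹ a) A.+ᴹ A.-ᴹ b)
regroup x a b = A.≈ᴹ-sym (begin
  (a A.+ᴹ b) A.+ᴹ z         ≈⟨ A.+ᴹ-comm _ z ⟩
  z A.+ᴹ (a A.+ᴹ b)         ≈⟨ A.+ᴹ-congˡ (A.+ᴹ-comm a b) ⟩
  z A.+ᴹ (b A.+ᴹ a)         ≈⟨ A.≈ᴹ-sym (A.+ᴹ-assoc z b a) ⟩
  (z A.+ᴹ b) A.+ᴹ a         ≈⟨ A.+ᴹ-congʳ (+-split ℚ⟨L⟩ _ b) ⟩
  (x A.+ᴹ A.-ᴹ a) A.+ᴹ a    ≈⟨ +-split ℚ⟨L⟩ x a ⟩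
  x                         ∎)
  where
  open SetoidReasoning A.≈ᴹ-setoid
  z : ∣ ℚ⟨L⟩ ∣ᴹ
  z = (x A.+ᴹ A.-ᴹ a) A.+ᴹ A.-ᴹ b

leibnizᴸ : ∀ a b → d ▹ (a ⧢ b) ≈[ A/L₋ ] ((d ▹ a) ⧢ b) A.+ᴹ (a ⧢ (d ▹ b))
leibnizᴸ = presented-ext {N = Hom ℚ⟨L⟩ A/L₋}
  (postcompose (ρ ∘ˡ prepend d) ∘ˡ shuffle)
  (LeftModule._+ᴹ_ (Hom ℚ⟨L⟩ (Hom ℚ⟨L⟩ A/L₋))
    (postcompose ρ ∘ˡ shuffle ∘ˡ prepend d)
    (postcompose ρ ∘ˡ precompose (prepend d) ∘ˡ shuffle))
  (λ u → presented-ext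
    (ρ ∘ˡ prepend d ∘ˡ to shuffle (gen u))
    (LeftModule._+ᴹ_ (Hom ℚ⟨L⟩ A/L₋)
      (ρ ∘ˡ to shuffle (gen (d ∷ u))) (ρ ∘ˡ to shuffle (gen u) ∘ˡ prepend d))
    (λ v → _ , ideal-gen (leibniz-defect 0 u v) , regroup _ _ _))
  where
  ρ : LinearMap ℚ⟨L⟩ A/L₋
  ρ = project ℚ⟨L⟩ L₋-isSubspace

L⊆S : ∀ {x} → L₋ x → S₋ x
L⊆S l = _ , _ , span-0 , l , A.≈ᴹ-sym (A.+ᴹ-identityˡ _)

T⊆S : ∀ {x} → T₋ x → S₋ x
T⊆S t = _ , _ , t , ideal-0 , A.≈ᴹ-sym (A.+ᴹ-identityʳ _)

leibniz : ∀ a b → d ▹ (a ⧢ b) ≈[ H₀ ] ((d ▹ a) ⧢ b) A.+ᴹ (a ⧢ (d ▹ b))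
leibniz a b = ≈ᴸ⇒≈ᴴ (leibnizᴸ a b)
  where
  ≈ᴸ⇒≈ᴴ : ∀ {x x′} → x ≈[ A/L₋ ] x′ → x ≈[ H₀ ] x′
  ≈ᴸ⇒≈ᴴ (l , Ll , e) = l , L⊆S Ll , e

L-resp : ∀ {x x′} → x ≈[ A/L₋ ] x′ → L₋ x′ → L₋ x
L-resp (l , Ll , e) p = ideal-resp (A.≈ᴹ-sym e) (ideal-+ p Ll)

L-prepend : ∀ x {a} → L₋ a → L₋ (x ▹ a)
L-prepend y {a} p =
  ideal-resp (A.≈ᴹ-trans (y-⧢ (gen []) a) (LinearMap.cong (prepend y) (1-⧢ a)))
    (ideal-⧢ˡ (gen [ y ]) p)
L-prepend d (ideal-gen (leibniz-defect k u v)) = ideal-gen (leibniz-defect (suc k) u v)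
L-prepend d ideal-0        = ideal-0
L-prepend d (ideal-+ p q)  = ideal-+ (L-prepend d p) (L-prepend d q)
L-prepend d (ideal-· r p)  = ideal-· r (L-prepend d p)
L-prepend d (ideal-⧢ˡ a {x} p) = L-resp (leibnizᴸ a x)
  (ideal-+ (ideal-⧢ˡ (d ▹ a) p) (ideal-⧢ˡ a (L-prepend d p)))
L-prepend d (ideal-⧢ʳ a {x} p) = L-resp (leibnizᴸ x a)
  (ideal-+ (ideal-⧢ʳ a (L-prepend d p)) (ideal-⧢ʳ (d ▹ a) p))
L-prepend d (ideal-resp e p) = ideal-resp (LinearMap.cong (prepend d) e) (L-prepend d p)

T-prepend : ∀ x {a} → T₋ a → T₋ (x ▹ a)
T-prepend x (span-gen (ends-in-d w)) = span-gen (ends-in-d (x ∷ w))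
T-prepend x span-0          = span-0
T-prepend x (span-+ p q)    = span-+ (T-prepend x p) (T-prepend x q)
T-prepend x (span-· r p)    = span-· r (T-prepend x p)
T-prepend x (span-resp e p) = span-resp (LinearMap.cong (prepend x) e) (T-prepend x p)

vanishᴴ : ∀ {a} → S₋ a → a ≈[ H₀ ] H.0ᴹ
vanishᴴ = vanish ℚ⟨L⟩ S₋-isSubspace

prependᴴ : Letter → LinearMap H₀ H₀
prependᴴ x = quotientMap ℚ⟨L⟩ S₋-isSubspace (π ∘ˡ prepend x)
  (λ (_ , _ , t , l , e) →
    vanishᴴ (_ , _ , T-prepend x t , L-prepend x l , LinearMap.cong (prepend x) e))

cancelʳ : ∀ {x a b} → x ≈[ H₀ ] a H.+ᴹ b → x ≈[ H₀ ] b → a ≈[ H₀ ] H.0ᴹ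
cancelʳ {x} {a} {b} p q = begin
  a             ≈⟨ H.≈ᴹ-sym (+-cancel H₀ p) ⟩
  x H.+ᴹ H.-ᴹ b ≈⟨ H.+ᴹ-congʳ q ⟩
  b H.+ᴹ H.-ᴹ b ≈⟨ H.-ᴹ‿inverseʳ b ⟩
  H.0ᴹ          ∎
  where open SetoidReasoning H.≈ᴹ-setoid

ends-in-d-⧢ : ∀ w a → gen (w ∷ʳ d) ⧢ a ≈[ H₀ ] H.0ᴹ
ends-in-d-⧢ [] a = cancelʳ (leibniz (gen []) a)
  (LinearMap.cong π (A.≈ᴹ-trans (LinearMap.cong (prepend d) (1-⧢ a)) (A.≈ᴹ-sym (1-⧢ (d ▹ a)))))
ends-in-d-⧢ (y ∷ w) a = H.≈ᴹ-trans (LinearMap.cong π (y-⧢ (gen (w ∷ʳ d)) a))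
  (LinearMap.cong (prependᴴ y) (ends-in-d-⧢ w a))
ends-in-d-⧢ (d ∷ w) a = cancelʳ (leibniz (gen (w ∷ʳ d)) a)
  (H.≈ᴹ-trans (LinearMap.cong (prependᴴ d) (ends-in-d-⧢ w a))
    (H.≈ᴹ-sym (ends-in-d-⧢ w (d ▹ a))))

⧢-ends-in-d : ∀ w a → a ⧢ gen (w ∷ʳ d) ≈[ H₀ ] H.0ᴹ
⧢-ends-in-d [] a = cancelʳ (H.≈ᴹ-trans (leibniz a (gen [])) (H.+ᴹ-comm _ _))
  (LinearMap.cong π (A.≈ᴹ-trans (LinearMap.cong (prepend d) (⧢-1 a)) (A.≈ᴹ-sym (⧢-1 (d ▹ a)))))
⧢-ends-in-d (y ∷ w) a = H.≈ᴹ-trans (LinearMap.cong π (⧢-y a (gen (w ∷ʳ d))))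
  (LinearMap.cong (prependᴴ y) (⧢-ends-in-d w a))
⧢-ends-in-d (d ∷ w) a =
  cancelʳ (H.≈ᴹ-trans (leibniz a (gen (w ∷ʳ d))) (H.+ᴹ-comm _ _))
  (H.≈ᴹ-trans (LinearMap.cong (prependᴴ d) (⧢-ends-in-d w a))
    (H.≈ᴹ-sym (⧢-ends-in-d w (d ▹ a))))

module _ {N : Vect} (f : LinearMap ℚ⟨L⟩ N) where
  private
    module N = LeftModule N
    module F = LinearMap f

  vanish-T : (∀ w → to f (gen (w ∷ʳ d)) ≈[ N ] N.0ᴹ) → ∀ {a} → T₋ a → to f a ≈[ N ] N.0ᴹ
  vanish-T h (span-gen (ends-in-d w)) = h w
  vanish-T h span-0          = F.0ᴹ-homo
  vanish-T h (span-+ p q)    = N.≈ᴹ-trans (F.+ᴹ-homo _ _)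
    (N.≈ᴹ-trans (N.+ᴹ-cong (vanish-T h p) (vanish-T h q)) (N.+ᴹ-identityˡ _))
  vanish-T h (span-· r p)    = N.≈ᴹ-trans (F.*ₗ-homo r _)
    (N.≈ᴹ-trans (N.*ₗ-congˡ (vanish-T h p)) (N.*ₗ-zeroʳ r))
  vanish-T h (span-resp e p) = N.≈ᴹ-trans (F.cong (A.≈ᴹ-sym e)) (vanish-T h p)

  vanish-S : (∀ w → to f (gen (w ∷ʳ d)) ≈[ N ] N.0ᴹ) →
             (∀ {a} → L₋ a → to f a ≈[ N ] N.0ᴹ) →
             ∀ {a} → S₋ a → to f a ≈[ N ] N.0ᴹ
  vanish-S h h′ (_ , _ , t , l , e) = N.≈ᴹ-trans (F.cong e) (N.≈ᴹ-trans (F.+ᴹ-homo _ _)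
    (N.≈ᴹ-trans (N.+ᴹ-cong (vanish-T h t) (h′ l)) (N.+ᴹ-identityˡ _)))

shuffleᴬᴴ : LinearMap ℚ⟨L⟩ (Hom H₀ H₀)
shuffleᴬᴴ = linearMap
  (λ a → quotientMap ℚ⟨L⟩ S₋-isSubspace (π ∘ˡ to shuffle a)
    (vanish-S (π ∘ˡ to shuffle a) (λ w → ⧢-ends-in-d w a)
      (λ l → vanishᴴ (L⊆S (ideal-⧢ˡ a l)))))
  (λ p b → LinearMap.cong π (LinearMap.cong shuffle p b))
  (λ _ _ _ → H.≈ᴹ-refl) (λ _ _ _ → H.≈ᴹ-refl)

shuffleᴴ : LinearMap H₀ (Hom H₀ H₀)
shuffleᴴ = quotientMap ℚ⟨L⟩ S₋-isSubspace shuffleᴬᴴ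
  (vanish-S shuffleᴬᴴ ends-in-d-⧢ (λ l a → vanishᴴ (L⊆S (ideal-⧢ʳ a l))))

⊗-map : ∀ {M M′ N N′} →
        LinearMap (Hom M M′) (Hom (Hom N N′) (Hom (M ⊗ᴹ N) (M′ ⊗ᴹ N′)))
⊗-map {M} {M′} {N} {N′} = linearMap
  (λ f → linearMap (f ⊠_)
    (λ {g} {g′} p → presented-ext (f ⊠ g) (f ⊠ g′)
      (λ (m , n) → relation (⊗-cong M′.≈ᴹ-refl (p n))))
    (λ g g′ → presented-ext (f ⊠ (g +ʰ g′)) ((f ⊠ g) +ᵗ (f ⊠ g′))
      (λ (m , n) → relation (⊗-+ʳ _ _ _)))
    (λ r g → presented-ext (f ⊠ (r *ʰ g)) (r *ᵗ (f ⊠ g))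
      (λ (m , n) → relation (⊗-·ʳ _ _ _))))
  (λ {f} {f′} p g → presented-ext (f ⊠ g) (f′ ⊠ g)
    (λ (m , n) → relation (⊗-cong (p m) N′.≈ᴹ-refl)))
  (λ f f′ g → presented-ext ((f +ʰ′ f′) ⊠ g) ((f ⊠ g) +ᵗ (f′ ⊠ g))
    (λ (m , n) → relation (⊗-+ˡ _ _ _)))
  (λ r f g → presented-ext ((r *ʰ′ f) ⊠ g) (r *ᵗ (f ⊠ g))
    (λ (m , n) → relation (⊗-·ˡ _ _ _)))
  where
  module M′ = LeftModule M′
  module N′ = LeftModule N′
  open LeftModule (Hom N N′) using () renaming (_+ᴹ_ to _+ʰ_; _*ₗ_ to _*ʰ_)
  open LeftModule (Hom M M′) using () renaming (_+ᴹ_ to _+ʰ′_; _*ₗ_ to _*ʰ′_)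
  open LeftModule (Hom (M ⊗ᴹ N) (M′ ⊗ᴹ N′)) using () renaming (_+ᴹ_ to _+ᵗ_; _*ₗ_ to _*ᵗ_)
  _⊠_ : LinearMap M M′ → LinearMap N N′ → LinearMap (M ⊗ᴹ N) (M′ ⊗ᴹ N′)
  f ⊠ g = uncurryˡ (precompose g ∘ˡ tensor ∘ˡ f)

mul : LinearMap H₀⊗H₀ (Hom H₀⊗H₀ H₀⊗H₀)
mul = uncurryˡ {H₀} {H₀} (precompose shuffleᴴ ∘ˡ ⊗-map {H₀} {H₀} {H₀} {H₀} ∘ˡ shuffleᴴ)

infixl 7 _⊛_
_⊛_ : ∣ H₀⊗H₀ ∣ᴹ → ∣ H₀⊗H₀ ∣ᴹ → ∣ H₀⊗H₀ ∣ᴹ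
U ⊛ V = to (to mul U) V

actˡ : Letter → LinearMap H₀⊗H₀ H₀⊗H₀
actˡ x = uncurryˡ (LeftModule._+ᴹ_ (Hom H₀ (Hom H₀ H₀⊗H₀))
  (tensor ∘ˡ prependᴴ x) (precompose (prependᴴ x) ∘ˡ tensor))

act : Letter → ∣ H₀⊗H₀ ∣ᴹ → ∣ H₀⊗H₀ ∣ᴹ
act x U = to (actˡ x) U

ext₂ : (f g : LinearMap H₀⊗H₀ (Hom H₀⊗H₀ H₀⊗H₀)) →
       (∀ a b a′ b′ → to (to f (a ⊗ b)) (a′ ⊗ b′) ≈[ H₀⊗H₀ ] to (to g (a ⊗ b)) (a′ ⊗ b′)) →
       ∀ U V → to (to f U) V ≈[ H₀⊗H₀ ] to (to g U) V
ext₂ f g p = presented-ext f g (λ (a , b) → presented-ext (to f (a ⊗ b)) (to g (a ⊗ b))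
  (λ (a′ , b′) → p a b a′ b′))

act-y-⊛ : ∀ U V → act y U ⊛ V ≈[ H₀⊗H₀ ] act y (U ⊛ V)
act-y-⊛ = ext₂ (mul ∘ˡ actˡ y) (postcompose (actˡ y) ∘ˡ mul) (λ a b a′ b′ →
  +-cong (relation (⊗-cong (LinearMap.cong π (y-⧢ a a′)) H.≈ᴹ-refl))
         (relation (⊗-cong H.≈ᴹ-refl (LinearMap.cong π (y-⧢ b b′)))))

⊛-act-y : ∀ U V → U ⊛ act y V ≈[ H₀⊗H₀ ] act y (U ⊛ V)
⊛-act-y = ext₂ (precompose (actˡ y) ∘ˡ mul) (postcompose (actˡ y) ∘ˡ mul) (λ a b a′ b′ →
  +-cong (relation (⊗-cong (LinearMap.cong π (⧢-y a a′)) H.≈ᴹ-refl))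
         (relation (⊗-cong H.≈ᴹ-refl (LinearMap.cong π (⧢-y b b′)))))

act-d-⊛ : ∀ U V → act d (U ⊛ V) ≈[ H₀⊗H₀ ] (act d U ⊛ V) TT.+ᴹ (U ⊛ act d V)
act-d-⊛ = ext₂ (postcompose (actˡ d) ∘ˡ mul)
  (LeftModule._+ᴹ_ (Hom H₀⊗H₀ (Hom H₀⊗H₀ H₀⊗H₀))
    (mul ∘ˡ actˡ d) (precompose (actˡ d) ∘ˡ mul))
  (λ a b a′ b′ → TT.≈ᴹ-trans
    (+-cong
      (transitive (relation (⊗-cong (leibniz a a′) H.≈ᴹ-refl)) (relation (⊗-+ˡ _ _ _)))
      (transitive (relation (⊗-cong H.≈ᴹ-refl (leibniz b b′))) (relation (⊗-+ʳ _ _ _))))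
    (+-interchange H₀⊗H₀ _ _ _ _))

1-⊛ : ∀ V → (𝟏 ⊗ 𝟏) ⊛ V ≈[ H₀⊗H₀ ] V
1-⊛ = presented-ext (to mul (𝟏 ⊗ 𝟏)) idˡ (λ (a , b) →
  relation (⊗-cong (LinearMap.cong π (1-⧢ a)) (LinearMap.cong π (1-⧢ b))))

⊛-1 : ∀ U → U ⊛ (𝟏 ⊗ 𝟏) ≈[ H₀⊗H₀ ] U
⊛-1 = presented-ext (to (flipˡ mul) (𝟏 ⊗ 𝟏)) idˡ (λ (a , b) →
  relation (⊗-cong (LinearMap.cong π (⧢-1 a)) (LinearMap.cong π (⧢-1 b))))

primʷ : Word → ∣ H₀⊗H₀ ∣ᴹ
primʷ []      = 𝟏 ⊗ 𝟏
primʷ (x ∷ w) = act x (primʷ w)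

prim : LinearMap ℚ⟨L⟩ H₀⊗H₀
prim = freeMap primʷ

prim-prepend : ∀ x a → to prim (x ▹ a) ≈[ H₀⊗H₀ ] act x (to prim a)
prim-prepend x = presented-ext (prim ∘ˡ prepend x) (actˡ x ∘ˡ prim) (λ _ → TT.≈ᴹ-refl)

prim-⧢ʷ : ∀ u v → to prim (u ⧢ʷ v) ≈[ H₀⊗H₀ ] primʷ u ⊛ primʷ v
prim-⧢ʷ [] v = TT.≈ᴹ-sym (1-⊛ _)
prim-⧢ʷ (y ∷ u) v = begin
  to prim (y ▹ (u ⧢ʷ v))    ≈⟨ prim-prepend y (u ⧢ʷ v) ⟩
  act y (to prim (u ⧢ʷ v))  ≈⟨ LinearMap.cong (actˡ y) (prim-⧢ʷ u v) ⟩
  act y (primʷ u ⊛ primʷ v) ≈⟨ TT.≈ᴹ-sym (act-y-⊛ (primʷ u) (primʷ v)) ⟩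
  act y (primʷ u) ⊛ primʷ v ∎
  where open SetoidReasoning TT.≈ᴹ-setoid
prim-⧢ʷ (d ∷ u) [] = TT.≈ᴹ-sym (⊛-1 _)
prim-⧢ʷ (d ∷ u) (y ∷ v) = begin
  to prim (y ▹ ((d ∷ u) ⧢ʷ v))    ≈⟨ prim-prepend y ((d ∷ u) ⧢ʷ v) ⟩
  act y (to prim ((d ∷ u) ⧢ʷ v))  ≈⟨ LinearMap.cong (actˡ y) (prim-⧢ʷ (d ∷ u) v) ⟩
  act y (primʷ (d ∷ u) ⊛ primʷ v) ≈⟨ TT.≈ᴹ-sym (⊛-act-y (primʷ (d ∷ u)) (primʷ v)) ⟩
  primʷ (d ∷ u) ⊛ act y (primʷ v) ∎
  where open SetoidReasoning TT.≈ᴹ-setoid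
prim-⧢ʷ (d ∷ u) (d ∷ v) = begin
  to prim (d ▹ X) TT.+ᴹ TT.-ᴹ to prim (u ⧢ʷ (d ∷ d ∷ v))
    ≈⟨ TT.+ᴹ-cong
         (TT.≈ᴹ-trans (prim-prepend d X) (LinearMap.cong (actˡ d) (prim-⧢ʷ u (d ∷ v))))
         (TT.-ᴹ‿cong (prim-⧢ʷ u (d ∷ d ∷ v))) ⟩
  act d (primʷ u ⊛ primʷ (d ∷ v)) TT.+ᴹ TT.-ᴹ (primʷ u ⊛ act d (primʷ (d ∷ v)))
    ≈⟨ +-cancel H₀⊗H₀ (act-d-⊛ (primʷ u) (primʷ (d ∷ v))) ⟩
  primʷ (d ∷ u) ⊛ primʷ (d ∷ v) ∎
  where
  open SetoidReasoning TT.≈ᴹ-setoid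
  X : ∣ ℚ⟨L⟩ ∣ᴹ
  X = u ⧢ʷ (d ∷ v)

prim-⧢ : ∀ a b → to prim (a ⧢ b) ≈[ H₀⊗H₀ ] to prim a ⊛ to prim b
prim-⧢ = presented-ext {N = Hom ℚ⟨L⟩ H₀⊗H₀}
  (postcompose prim ∘ˡ shuffle) (precompose prim ∘ˡ mul ∘ˡ prim)
  (λ u → presented-ext (prim ∘ˡ to shuffle (gen u)) (to mul (primʷ u) ∘ˡ prim)
    (λ v → prim-⧢ʷ u v))

⊗-0ˡ : ∀ {a} b → a ≈[ H₀ ] H.0ᴹ → a ⊗ b ≈[ H₀⊗H₀ ] TT.0ᴹ
⊗-0ˡ b p = TT.≈ᴹ-trans (LinearMap.cong tensor p b) (LinearMap.0ᴹ-homo tensor b)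

⊗-0ʳ : ∀ a {b} → b ≈[ H₀ ] H.0ᴹ → a ⊗ b ≈[ H₀⊗H₀ ] TT.0ᴹ
⊗-0ʳ a p = TT.≈ᴹ-trans (LinearMap.cong (to tensor a) p) (LinearMap.0ᴹ-homo (to tensor a))

word-0 : ∀ w → word (w ∷ʳ d) ≈[ H₀ ] H.0ᴹ
word-0 w = vanishᴴ (T⊆S (span-gen (ends-in-d w)))

prim-T : ∀ w → primʷ (w ∷ʳ d) ≈[ H₀⊗H₀ ] TT.0ᴹ
prim-T []      = TT.≈ᴹ-trans (TT.+ᴹ-cong (⊗-0ˡ 𝟏 (word-0 [])) (⊗-0ʳ 𝟏 (word-0 [])))
  (TT.+ᴹ-identityˡ _)
prim-T (x ∷ w) = TT.≈ᴹ-trans (LinearMap.cong (actˡ x) (prim-T w)) (LinearMap.0ᴹ-homo (actˡ x))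

prim-defect : ∀ k u v → to prim
  (d^ k ▹ ((d ▹ (gen u ⧢ gen v) A.+ᴹ A.-ᴹ (gen (d ∷ u) ⧢ gen v))
           A.+ᴹ A.-ᴹ (gen u ⧢ gen (d ∷ v)))) ≈[ H₀⊗H₀ ] TT.0ᴹ
prim-defect (suc k) u v = TT.≈ᴹ-trans
  (prim-prepend d
    (d^ k ▹ ((d ▹ (gen u ⧢ gen v) A.+ᴹ A.-ᴹ (gen (d ∷ u) ⧢ gen v))
             A.+ᴹ A.-ᴹ (gen u ⧢ gen (d ∷ v)))))
  (TT.≈ᴹ-trans (LinearMap.cong (actˡ d) (prim-defect k u v)) (LinearMap.0ᴹ-homo (actˡ d)))
prim-defect zero u v = begin
  (to prim (d ▹ (u ⧢ʷ v)) TT.+ᴹ TT.-ᴹ to prim ((d ∷ u) ⧢ʷ v))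
    TT.+ᴹ TT.-ᴹ to prim (u ⧢ʷ (d ∷ v))
    ≈⟨ TT.+ᴹ-cong (TT.+ᴹ-cong
         (TT.≈ᴹ-trans (prim-prepend d (u ⧢ʷ v)) (TT.≈ᴹ-trans
           (LinearMap.cong (actˡ d) (prim-⧢ʷ u v)) (act-d-⊛ (primʷ u) (primʷ v))))
         (TT.-ᴹ‿cong (prim-⧢ʷ (d ∷ u) v)))
         (TT.-ᴹ‿cong (prim-⧢ʷ u (d ∷ v))) ⟩
  ((P TT.+ᴹ Q) TT.+ᴹ TT.-ᴹ P) TT.+ᴹ TT.-ᴹ Q
    ≈⟨ TT.+ᴹ-congʳ (+-cancel H₀⊗H₀ (TT.+ᴹ-comm P Q)) ⟩
  Q TT.+ᴹ TT.-ᴹ Q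
    ≈⟨ TT.-ᴹ‿inverseʳ Q ⟩
  TT.0ᴹ ∎
  where
  open SetoidReasoning TT.≈ᴹ-setoid
  P Q : ∣ H₀⊗H₀ ∣ᴹ
  P = primʷ (d ∷ u) ⊛ primʷ v
  Q = primʷ u ⊛ primʷ (d ∷ v)

prim-L : ∀ {a} → L₋ a → to prim a ≈[ H₀⊗H₀ ] TT.0ᴹ
prim-L (ideal-gen (leibniz-defect k u v)) = prim-defect k u v
prim-L ideal-0       = TT.≈ᴹ-refl
prim-L (ideal-+ p q) = TT.≈ᴹ-trans (TT.+ᴹ-cong (prim-L p) (prim-L q)) (TT.+ᴹ-identityˡ _)
prim-L (ideal-· r p) = TT.≈ᴹ-trans (TT.*ₗ-congˡ (prim-L p)) (TT.*ₗ-zeroʳ r)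
prim-L (ideal-⧢ˡ a {x} p) = TT.≈ᴹ-trans (prim-⧢ a x)
  (TT.≈ᴹ-trans (LinearMap.cong (to mul (to prim a)) (prim-L p))
    (LinearMap.0ᴹ-homo (to mul (to prim a))))
prim-L (ideal-⧢ʳ a {x} p) = TT.≈ᴹ-trans (prim-⧢ x a)
  (TT.≈ᴹ-trans (LinearMap.cong mul (prim-L p) (to prim a)) (LinearMap.0ᴹ-homo mul (to prim a)))
prim-L (ideal-resp e p) = TT.≈ᴹ-trans (LinearMap.cong prim (A.≈ᴹ-sym e)) (prim-L p)

∑-cong : {I : Set} (is : List I) {f g : I → ∣ H₀⊗H₀ ∣ᴹ} →
         (∀ i → f i ≈[ H₀⊗H₀ ] g i) → ∑ H₀⊗H₀ is f ≈[ H₀⊗H₀ ] ∑ H₀⊗H₀ is g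
∑-cong []       p = TT.≈ᴹ-refl
∑-cong (i ∷ is) p = TT.+ᴹ-cong (p i) (∑-cong is p)

∑-++ : {I : Set} (is js : List I) (f : I → ∣ H₀⊗H₀ ∣ᴹ) →
       ∑ H₀⊗H₀ (is ++ js) f ≈[ H₀⊗H₀ ] ∑ H₀⊗H₀ is f TT.+ᴹ ∑ H₀⊗H₀ js f
∑-++ []       js f = TT.≈ᴹ-sym (TT.+ᴹ-identityˡ _)
∑-++ (i ∷ is) js f = TT.≈ᴹ-trans (TT.+ᴹ-congˡ (∑-++ is js f)) (TT.≈ᴹ-sym (TT.+ᴹ-assoc _ _ _))

∑-map : {I J : Set} (h : I → J) (is : List I) (f : J → ∣ H₀⊗H₀ ∣ᴹ) →
        ∑ H₀⊗H₀ (map h is) f ≈[ H₀⊗H₀ ] ∑ H₀⊗H₀ is (λ i → f (h i))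
∑-map h []       f = TT.≈ᴹ-refl
∑-map h (i ∷ is) f = TT.+ᴹ-congˡ (∑-map h is f)

∑-+ : {I : Set} (is : List I) (f g : I → ∣ H₀⊗H₀ ∣ᴹ) →
      ∑ H₀⊗H₀ is (λ i → f i TT.+ᴹ g i) ≈[ H₀⊗H₀ ] ∑ H₀⊗H₀ is f TT.+ᴹ ∑ H₀⊗H₀ is g
∑-+ []       f g = TT.≈ᴹ-sym (TT.+ᴹ-identityˡ _)
∑-+ (i ∷ is) f g = TT.≈ᴹ-trans (TT.+ᴹ-congˡ (∑-+ is f g)) (+-interchange H₀⊗H₀ _ _ _ _)

∑-act : {I : Set} (x : Letter) (is : List I) (f : I → ∣ H₀⊗H₀ ∣ᴹ) →
        act x (∑ H₀⊗H₀ is f) ≈[ H₀⊗H₀ ] ∑ H₀⊗H₀ is (λ i → act x (f i))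
∑-act x []       f = LinearMap.0ᴹ-homo (actˡ x)
∑-act x (i ∷ is) f = TT.≈ᴹ-trans (LinearMap.+ᴹ-homo (actˡ x) (f i) (∑ H₀⊗H₀ is f))
  (TT.+ᴹ-congˡ (∑-act x is f))

∑-filter : {I : Set} {P : Pred I 0ℓ} (P? : Decidable P) (is : List I) {f : I → ∣ H₀⊗H₀ ∣ᴹ} →
           (∀ i → ¬ P i → f i ≈[ H₀⊗H₀ ] TT.0ᴹ) →
           ∑ H₀⊗H₀ (filter P? is) f ≈[ H₀⊗H₀ ] ∑ H₀⊗H₀ is f
∑-filter P? []       h = TT.≈ᴹ-refl
∑-filter P? (i ∷ is) h with P? i
... | yes _ = TT.+ᴹ-congˡ (∑-filter P? is h)
... | no ¬p = TT.≈ᴹ-trans (∑-filter P? is h)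
  (TT.≈ᴹ-sym (TT.≈ᴹ-trans (TT.+ᴹ-congʳ (h i ¬p)) (TT.+ᴹ-identityˡ _)))

deconcatenate : ∀ w → ∑ H₀⊗H₀ (subsets (length w)) (λ S → w ‖ S ⊗ʷ w ‖ ∁ S)
                      ≈[ H₀⊗H₀ ] primʷ w
deconcatenate []      = TT.+ᴹ-identityʳ _
deconcatenate (x ∷ w) = begin
  ∑ H₀⊗H₀ (map (inside ∷_) Ss ++ map (outside ∷_) Ss) f
    ≈⟨ ∑-++ (map (inside ∷_) Ss) _ f ⟩
  ∑ H₀⊗H₀ (map (inside ∷_) Ss) f TT.+ᴹ ∑ H₀⊗H₀ (map (outside ∷_) Ss) f
    ≈⟨ TT.+ᴹ-cong (∑-map (inside ∷_) Ss f) (∑-map (outside ∷_) Ss f) ⟩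
  ∑ H₀⊗H₀ Ss (λ S → (x ∷ w ‖ S) ⊗ʷ w ‖ ∁ S) TT.+ᴹ ∑ H₀⊗H₀ Ss (λ S → w ‖ S ⊗ʷ (x ∷ w ‖ ∁ S))
    ≈⟨ TT.≈ᴹ-sym (∑-+ Ss _ _) ⟩
  ∑ H₀⊗H₀ Ss (λ S → act x (w ‖ S ⊗ʷ w ‖ ∁ S))
    ≈⟨ TT.≈ᴹ-sym (∑-act x Ss _) ⟩
  act x (∑ H₀⊗H₀ Ss (λ S → w ‖ S ⊗ʷ w ‖ ∁ S))
    ≈⟨ LinearMap.cong (actˡ x) (deconcatenate w) ⟩
  act x (primʷ w) ∎
  where
  open SetoidReasoning TT.≈ᴹ-setoid
  Ss : List (Subset (length w))
  Ss = subsets (length w)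
  f : Subset (suc (length w)) → ∣ H₀⊗H₀ ∣ᴹ
  f S = (x ∷ w) ‖ S ⊗ʷ (x ∷ w) ‖ ∁ S

word-∉Y : ∀ w → ¬ Y w → word w ≈[ H₀ ] H.0ᴹ
word-∉Y w w∉Y with initLast w
... | []      = contradiction (inj₁ refl) w∉Y
... | u ∷ʳ′ y = contradiction (inj₂ (u , refl)) w∉Y
... | u ∷ʳ′ d = word-0 u

inadmissible : ∀ w S → ¬ Admissible w S → w ‖ S ⊗ʷ w ‖ ∁ S ≈[ H₀⊗H₀ ] TT.0ᴹ
inadmissible w S ¬adm with Y? (w ‖ S) | Y? (w ‖ ∁ S)
... | no ∉Y  | _      = ⊗-0ˡ (word (w ‖ ∁ S)) (word-∉Y (w ‖ S) ∉Y)
... | yes _  | no ∉Y  = ⊗-0ʳ (word (w ‖ S)) (word-∉Y (w ‖ ∁ S) ∉Y)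
... | yes ∈Y | yes ∈Y′ = contradiction (∈Y , ∈Y′) ¬adm

Δ₀ʷ-prim : ∀ w → Δ₀ʷ w ≈[ H₀⊗H₀ ] primʷ w
Δ₀ʷ-prim w = TT.≈ᴹ-trans
  (∑-filter (admissible? w) (subsets (length w)) (inadmissible w)) (deconcatenate w)

Δ₀-prim : ∀ a → to (freeMap Δ₀ʷ) a ≈[ H₀⊗H₀ ] to prim a
Δ₀-prim = presented-ext (freeMap Δ₀ʷ) prim Δ₀ʷ-prim

Δ₀ : LinearMap H₀ H₀⊗H₀
Δ₀ = quotientMap ℚ⟨L⟩ S₋-isSubspace (freeMap Δ₀ʷ)
  (λ {a} s → TT.≈ᴹ-trans (Δ₀-prim a) (vanish-S prim prim-T prim-L s))

Δ̃₀ : LinearMap H₀ H₀⊗H₀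
Δ̃₀ = Δ₀ − to tensor 𝟏 − to (flipˡ tensor) 𝟏
  where
  open LeftModule (Hom H₀ H₀⊗H₀)
  infixl 6 _−_
  _−_ : LinearMap H₀ H₀⊗H₀ → LinearMap H₀ H₀⊗H₀ → LinearMap H₀ H₀⊗H₀
  f − g = f +ᴹ -ᴹ g

------------------------------------------------------------------------
-- The words w_{k₁}⋯w_{kₙ} and the two sums for their reduced coproduct

dⁿ : ℕ → Word
dⁿ m = replicate m d

dⁿy : ℕ → Word
dⁿy m = dⁿ m ++ [ y ]

w⋯ : List ℕ → Word
w⋯ = concatMap dⁿy

infixr 7 _·_
_·_ : ℕ → ∣ H₀⊗H₀ ∣ᴹ → ∣ H₀⊗H₀ ∣ᴹ
c · U = ((+ c) / 1) TT.*ₗ U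

-- all (i , j) with i + j = k
splits : ℕ → List (ℕ × ℕ)
splits k = applyUpTo (λ i → i , k ∸ i) (suc k)

-- all ((i₁ , j₁) , … , (iₘ , jₘ)) with iₐ + jₐ = kₐ
multisplits : List ℕ → List (List (ℕ × ℕ))
multisplits []       = [ [] ]
multisplits (k ∷ ks) = cartesianProductWith _∷_ (splits k) (multisplits ks)

∏binom : List ℕ → List (ℕ × ℕ) → ℕ
∏binom ks ijs = product (zipWith (λ k (i , _) → k C i) ks ijs)

-- all (u₁⋯uₘ , v₁⋯vₘ) with (u_q , v_q) = (d^{i_q} , d^{j_q} y) or (d^{j_q} y , d^{i_q})
distributions : List (ℕ × ℕ) → List (Word × Word)
distributions []              = [ ([] , []) ]
distributions ((i , j) ∷ ijs) = cartesianProductWith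
  (λ (u , v) (u′ , v′) → u ++ u′ , v ++ v′)
  ((dⁿ i , dⁿy j) ∷ (dⁿy j , dⁿ i) ∷ [])
  (distributions ijs)

firstSum : ∀ {n} → Vec ℕ (suc n) → ∣ H₀⊗H₀ ∣ᴹ
firstSum (k₁ ∷ ks) = ∑ H₀⊗H₀ (splits k₁) λ (i , j) →
  (k₁ C i) · (dⁿy i ⊗sym (dⁿ j ++ w⋯ (toList ks)))

-- The summand for p; since Fin n counts from 0, c stands for p - 1.
pSum : ∀ {n} → Vec ℕ n → Fin n → ∣ H₀⊗H₀ ∣ᴹ
pSum k c =
  ∑ H₀⊗H₀ (multisplits before) λ ijs →
  ∑ H₀⊗H₀ (splits kₚ) λ (iₚ , jₚ) →
  (∏binom before ijs ℕ.* (kₚ C iₚ)) ·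
  ∑ H₀⊗H₀ (distributions ijs) λ (u , v) →
  (u ++ dⁿy iₚ) ⊗sym (v ++ dⁿ jₚ ++ w⋯ after)
  where
  before after : List ℕ
  before = take (toℕ c) (toList k)
  after  = drop (suc (toℕ c)) (toList k)
  kₚ : ℕ
  kₚ = lookup k c

{-# OPTIONS --safe #-}
module Submission where

-- Δ₀ w = ∏ (x ⊗ 1 + 1 ⊗ x) over the letters x of w, so Δ₀ of w_{k₁}⋯w_{kₙ} is obtained by
-- applying the block operator of d^k y = dⁿy k for k = kₙ, …, k₁ to 1 ⊗ 1. By the binomial
-- theorem this operator is ∑_{i+j=k} (k C i) (dⁱ ⊗ dʲy + dʲy ⊗ dⁱ), which is how a pair of
-- words is distributed in the p-sum; it therefore turns the p-sum for k₂, …, kₙ into the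
-- (p+1)-sum for k₁, …, kₙ. Applied to 1 ⊗sym w it gives 1 ⊗sym d^k y w plus the first sum:
-- since words ending in d vanish in H₀, d^k can only act on the second factor of 1 ⊗sym y w,
-- whereas on y ⊗sym w it acts by the binomial theorem.

open import Defs
open import Data.Nat using (ℕ; _+_)
open import Data.Fin using (suc; inject₁)
open import Data.List using (allFin)
open import Data.Vec using (Vec; toList)
open import Algebra.Module.Bundles using (module LeftModule)

open import Data.Fin using (Fin; zero; toℕ)
open import Data.Integer using (+_)
import Data.Integer as ℤ
import Data.Integer.Properties as ℤ
open import Data.List
  using (List; []; _∷_; [_]; _++_; _∷ʳ_; map; foldr; take; drop; applyUpTo; upTo;
         cartesianProductWith)
import Data.List.Properties as List
open import Data.Nat using (zero; suc; _*_; _∸_; _≤?_)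
open import Data.Nat.Combinatorics using (_C_; nCk+nC[k+1]≡[n+1]C[k+1]; k>n⇒nCk≡0)
import Data.Nat.Coprimality as Coprimality
import Data.Nat.Properties as ℕ
open import Data.Product using (_×_; _,_)
open import Data.Rational using (_/_; mkℚ)
import Data.Rational as ℚ
open import Data.Rational.Properties using (normalize-coprime)
open import Data.Vec using ([]; _∷_; lookup)
import Relation.Binary.Reasoning.Setoid as SetoidReasoning
open import Relation.Binary.PropositionalEquality as ≡ using (_≡_; refl)
open import Relation.Nullary using (yes; no)

private
  module TT = LeftModule H₀⊗H₀

open SetoidReasoning TT.≈ᴹ-setoid

-- Finite sums and natural-number multiples in `H₀⊗H₀`.

⨁ : {I : Set} → List I → (I → ∣ H₀⊗H₀ ∣ᴹ) → ∣ H₀⊗H₀ ∣ᴹ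
⨁ = ∑ H₀⊗H₀

-- For a variable `a` the normalisation in `_/_` is stuck on a gcd; in the `mkℚ` form the sum and
-- product of rationals compute.
/1-mkℚ : ∀ a → (+ a) / 1 ≡ mkℚ (+ a) 0 (Coprimality.sym (Coprimality.1-coprimeTo a))
/1-mkℚ a = normalize-coprime (Coprimality.sym (Coprimality.1-coprimeTo a))

/1-+ : ∀ a b → (+ (a + b)) / 1 ≡ ((+ a) / 1) ℚ.+ ((+ b) / 1)
/1-+ a b = ≡.sym (≡.trans (≡.cong₂ ℚ._+_ (/1-mkℚ a) (/1-mkℚ b))
  (≡.cong (_/ 1) (≡.cong₂ ℤ._+_ (ℤ.*-identityʳ (+ a)) (ℤ.*-identityʳ (+ b)))))

/1-* : ∀ a b → (+ (a * b)) / 1 ≡ ((+ a) / 1) ℚ.* ((+ b) / 1)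
/1-* a b = ≡.sym (≡.trans (≡.cong₂ ℚ._*_ (/1-mkℚ a) (/1-mkℚ b))
  (≡.cong (_/ 1) (≡.sym (ℤ.pos-* a b))))

·-+ : ∀ a b U → (a + b) · U ≈[ H₀⊗H₀ ] (a · U) TT.+ᴹ (b · U)
·-+ a b U = TT.≈ᴹ-trans (TT.≈ᴹ-reflexive (≡.cong (TT._*ₗ U) (/1-+ a b))) (TT.*ₗ-distribʳ U _ _)

·-* : ∀ a b U → (a * b) · U ≈[ H₀⊗H₀ ] a · b · U
·-* a b U = TT.≈ᴹ-trans (TT.≈ᴹ-reflexive (≡.cong (TT._*ₗ U) (/1-* a b))) (TT.*ₗ-assoc _ _ U)

∑-linear : {I : Set} (f : LinearMap H₀⊗H₀ H₀⊗H₀) (is : List I) (g : I → ∣ H₀⊗H₀ ∣ᴹ) →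
           to f (⨁ is g) ≈[ H₀⊗H₀ ] ⨁ is (λ i → to f (g i))
∑-linear f []       g = LinearMap.0ᴹ-homo f
∑-linear f (i ∷ is) g = TT.≈ᴹ-trans (LinearMap.+ᴹ-homo f (g i) (⨁ is g))
  (TT.+ᴹ-congˡ (∑-linear f is g))

∑-cartesianProductWith : {I J K : Set} (h : I → J → K) (is : List I) (js : List J)
  (f : K → ∣ H₀⊗H₀ ∣ᴹ) →
  ⨁ (cartesianProductWith h is js) f ≈[ H₀⊗H₀ ] ⨁ is (λ i → ⨁ js (λ j → f (h i j)))
∑-cartesianProductWith h []       js f = TT.≈ᴹ-refl
∑-cartesianProductWith h (i ∷ is) js f = TT.≈ᴹ-trans (∑-++ (map (h i) js) _ f)
  (TT.+ᴹ-cong (∑-map (h i) js f) (∑-cartesianProductWith h is js f))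

∑-allFin-suc : ∀ n (f : Fin (suc n) → ∣ H₀⊗H₀ ∣ᴹ) →
               ⨁ (allFin (suc n)) f ≈[ H₀⊗H₀ ] f zero TT.+ᴹ ⨁ (allFin n) (λ i → f (suc i))
∑-allFin-suc n f = TT.+ᴹ-congˡ (TT.≈ᴹ-trans
  (TT.≈ᴹ-reflexive (≡.cong (λ is → ⨁ is f) (≡.sym (List.map-tabulate (λ i → i) suc))))
  (∑-map suc (allFin n) f))

∑-applyUpTo-suc : {I : Set} (g : ℕ → I) (n : ℕ) (f : I → ∣ H₀⊗H₀ ∣ᴹ) →
                  ⨁ (applyUpTo g (suc n)) f ≈[ H₀⊗H₀ ] ⨁ (applyUpTo g n) f TT.+ᴹ f (g n)
∑-applyUpTo-suc g n f = begin
  ⨁ (applyUpTo g (suc n)) f                  ≡⟨ ≡.cong (λ is → ⨁ is f) (List.applyUpTo-∷ʳ g n) ⟨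
  ⨁ (applyUpTo g n ∷ʳ g n) f                 ≈⟨ ∑-++ (applyUpTo g n) [ g n ] f ⟩
  ⨁ (applyUpTo g n) f TT.+ᴹ (f (g n) TT.+ᴹ TT.0ᴹ) ≈⟨ TT.+ᴹ-congˡ (TT.+ᴹ-identityʳ (f (g n))) ⟩
  ⨁ (applyUpTo g n) f TT.+ᴹ f (g n)          ∎

∑-upTo : {I : Set} (g : ℕ → I) (n : ℕ) (f : I → ∣ H₀⊗H₀ ∣ᴹ) →
         ⨁ (applyUpTo g n) f ≈[ H₀⊗H₀ ] ⨁ (upTo n) (λ i → f (g i))
∑-upTo g n f = TT.≈ᴹ-trans
  (TT.≈ᴹ-reflexive (≡.cong (λ is → ⨁ is f) (≡.sym (List.map-upTo g n))))
  (∑-map g (upTo n) f)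

-- Binomial sums and Pascal's rule.

-- The sum of f i j over i + j = k with binomial weights, organised by Pascal's rule
-- instead of by binomial coefficients.
pascal : ℕ → (ℕ → ℕ → ∣ H₀⊗H₀ ∣ᴹ) → ∣ H₀⊗H₀ ∣ᴹ
pascal zero    f = f 0 0
pascal (suc k) f = pascal k (λ i j → f (suc i) j) TT.+ᴹ pascal k (λ i j → f i (suc j))

pascal-cong : ∀ k {f g} → (∀ i j → f i j ≈[ H₀⊗H₀ ] g i j) → pascal k f ≈[ H₀⊗H₀ ] pascal k g
pascal-cong zero    p = p 0 0
pascal-cong (suc k) p = TT.+ᴹ-cong (pascal-cong k (λ i j → p (suc i) j))
  (pascal-cong k (λ i j → p i (suc j)))

pascal-+ : ∀ k f g → pascal k (λ i j → f i j TT.+ᴹ g i j)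
                     ≈[ H₀⊗H₀ ] pascal k f TT.+ᴹ pascal k g
pascal-+ zero    f g = TT.≈ᴹ-refl
pascal-+ (suc k) f g = TT.≈ᴹ-trans (TT.+ᴹ-cong (pascal-+ k _ _) (pascal-+ k _ _))
  (+-interchange H₀⊗H₀ _ _ _ _)

-- Exchanging i and j exchanges the two branches of the recursion.
pascal-flip : ∀ k f → pascal k f ≈[ H₀⊗H₀ ] pascal k (λ i j → f j i)
pascal-flip zero    f = TT.≈ᴹ-refl
pascal-flip (suc k) f = TT.≈ᴹ-trans (TT.+ᴹ-cong (pascal-flip k _) (pascal-flip k _))
  (TT.+ᴹ-comm _ _)

pascal-linear : ∀ (h : LinearMap H₀⊗H₀ H₀⊗H₀) k f →
                to h (pascal k f) ≈[ H₀⊗H₀ ] pascal k (λ i j → to h (f i j))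
pascal-linear h zero    f = TT.≈ᴹ-refl
pascal-linear h (suc k) f = TT.≈ᴹ-trans (LinearMap.+ᴹ-homo h _ _)
  (TT.+ᴹ-cong (pascal-linear h k _) (pascal-linear h k _))

binomialSum : ℕ → (ℕ → ℕ → ∣ H₀⊗H₀ ∣ᴹ) → ∣ H₀⊗H₀ ∣ᴹ
binomialSum k f = ⨁ (upTo (suc k)) (λ i → (k C i) · f i (k ∸ i))

-- For i > k both sides are zero, although suc k ∸ i and suc (k ∸ i) then differ.
C·-suc-∸ : ∀ k i (f : ℕ → ∣ H₀⊗H₀ ∣ᴹ) → (k C i) · f (suc (k ∸ i)) ≈[ H₀⊗H₀ ] (k C i) · f (suc k ∸ i)
C·-suc-∸ k i f with i ≤? k
... | yes i≤k rewrite ℕ.+-∸-assoc 1 i≤k = TT.≈ᴹ-refl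
... | no i≰k rewrite k>n⇒nCk≡0 (ℕ.≰⇒> i≰k) =
  TT.≈ᴹ-trans (TT.*ₗ-zeroˡ _) (TT.≈ᴹ-sym (TT.*ₗ-zeroˡ _))

-- Pascal's rule splits every term except i = 0. The `k C i` parts form the first sum; the
-- `k C suc i` parts, completed by the term i = 0, form the second sum up to a vanishing last term.
binomialSum-suc : ∀ k f → binomialSum (suc k) f
  ≈[ H₀⊗H₀ ] binomialSum k (λ i j → f (suc i) j) TT.+ᴹ binomialSum k (λ i j → f i (suc j))
binomialSum-suc k f = begin
  a TT.+ᴹ ⨁ (applyUpTo suc (suc k)) (λ i → (suc k C i) · f i (suc k ∸ i))
    ≈⟨ TT.+ᴹ-congˡ (∑-upTo suc (suc k) _) ⟩
  a TT.+ᴹ ⨁ is (λ i → (suc k C suc i) · f (suc i) (k ∸ i))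
    ≈⟨ TT.+ᴹ-congˡ (∑-cong is (λ i → TT.≈ᴹ-trans
         (TT.≈ᴹ-reflexive (≡.cong (_· f (suc i) (k ∸ i)) (≡.sym (nCk+nC[k+1]≡[n+1]C[k+1] k i))))
         (·-+ (k C i) (k C suc i) _))) ⟩
  a TT.+ᴹ ⨁ is (λ i → b i TT.+ᴹ c (suc i))
    ≈⟨ TT.+ᴹ-congˡ (∑-+ is b (λ i → c (suc i))) ⟩
  a TT.+ᴹ (⨁ is b TT.+ᴹ ⨁ is (λ i → c (suc i)))
    ≈⟨ TT.≈ᴹ-sym (TT.+ᴹ-assoc _ _ _) ⟩
  (a TT.+ᴹ ⨁ is b) TT.+ᴹ ⨁ is (λ i → c (suc i))
    ≈⟨ TT.+ᴹ-congʳ (TT.+ᴹ-comm _ _) ⟩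
  (⨁ is b TT.+ᴹ a) TT.+ᴹ ⨁ is (λ i → c (suc i))
    ≈⟨ TT.+ᴹ-assoc _ _ _ ⟩
  ⨁ is b TT.+ᴹ (c 0 TT.+ᴹ ⨁ is (λ i → c (suc i)))
    ≈⟨ TT.+ᴹ-congˡ (TT.+ᴹ-congˡ (TT.≈ᴹ-sym (∑-upTo suc (suc k) c))) ⟩
  ⨁ is b TT.+ᴹ ⨁ (upTo (suc (suc k))) c
    ≈⟨ TT.+ᴹ-congˡ (∑-applyUpTo-suc (λ i → i) (suc k) c) ⟩
  ⨁ is b TT.+ᴹ (⨁ is c TT.+ᴹ c (suc k))
    ≈⟨ TT.+ᴹ-congˡ (TT.+ᴹ-congˡ c-last) ⟩
  ⨁ is b TT.+ᴹ (⨁ is c TT.+ᴹ TT.0ᴹ)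
    ≈⟨ TT.+ᴹ-congˡ (TT.+ᴹ-identityʳ _) ⟩
  ⨁ is b TT.+ᴹ ⨁ is c
    ≈⟨ TT.+ᴹ-congˡ (∑-cong is (λ i → TT.≈ᴹ-sym (C·-suc-∸ k i (f i)))) ⟩
  binomialSum k (λ i j → f (suc i) j) TT.+ᴹ binomialSum k (λ i j → f i (suc j)) ∎
  where
  is : List ℕ
  is = upTo (suc k)
  b c : ℕ → ∣ H₀⊗H₀ ∣ᴹ
  b i = (k C i) · f (suc i) (k ∸ i)
  c i = (k C i) · f i (suc k ∸ i)
  a : ∣ H₀⊗H₀ ∣ᴹ
  -- The weight `suc k C 0` of the split-off term is convertible with the weight `k C 0` in `c 0`.
  a = c 0
  c-last : c (suc k) ≈[ H₀⊗H₀ ] TT.0ᴹ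
  c-last rewrite k>n⇒nCk≡0 (ℕ.n<1+n k) = TT.*ₗ-zeroˡ _

pascal≈binomialSum : ∀ k f → pascal k f ≈[ H₀⊗H₀ ] binomialSum k f
pascal≈binomialSum zero    f =
  TT.≈ᴹ-sym (TT.≈ᴹ-trans (TT.+ᴹ-identityʳ _) (TT.*ₗ-identityˡ (f 0 0)))
pascal≈binomialSum (suc k) f = TT.≈ᴹ-trans
  (TT.+ᴹ-cong (pascal≈binomialSum k _) (pascal≈binomialSum k _))
  (TT.≈ᴹ-sym (binomialSum-suc k f))

pascal≈∑splits : ∀ k f → pascal k f
                         ≈[ H₀⊗H₀ ] ⨁ (splits k) (λ (i , j) → (k C i) · f i j)
pascal≈∑splits k f = TT.≈ᴹ-trans (pascal≈binomialSum k f)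
  (TT.≈ᴹ-sym (∑-upTo (λ i → i , k ∸ i) (suc k) _))

-- Prepending words to the two tensor factors.

prependsᴴ : Word → LinearMap H₀ H₀
prependsᴴ = foldr (λ x f → prependᴴ x ∘ˡ f) idˡ

prependsᴴ-word : ∀ u v → to (prependsᴴ u) (word v) ≡ word (u ++ v)
prependsᴴ-word []      v = refl
prependsᴴ-word (x ∷ u) v = ≡.cong (to (prependᴴ x)) (prependsᴴ-word u v)

prepends₂ : Word → Word → LinearMap H₀⊗H₀ H₀⊗H₀
prepends₂ u v = uncurryˡ (precompose (prependsᴴ v) ∘ˡ tensor ∘ˡ prependsᴴ u)

prepends₂-⊗ʷ : ∀ u v u′ v′ → to (prepends₂ u v) (u′ ⊗ʷ v′) ≡ (u ++ u′) ⊗ʷ (v ++ v′)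
prepends₂-⊗ʷ u v u′ v′ = ≡.cong₂ _⊗_ (prependsᴴ-word u u′) (prependsᴴ-word v v′)

prependsᴴ-∷ʳ : ∀ u x a → to (prependsᴴ (u ++ [ x ])) a ≡ to (prependsᴴ u) (to (prependᴴ x) a)
prependsᴴ-∷ʳ []      x a = refl
prependsᴴ-∷ʳ (z ∷ u) x a = ≡.cong (to (prependᴴ z)) (prependsᴴ-∷ʳ u x a)

-- The letter acts before the words are prepended, so it lands at their right ends; in
-- `act-prepends₂` it acts afterwards and lands at their left ends. The first places the y of a
-- block, the second its d's.
prepends₂-act : ∀ x u v U → to (prepends₂ u v) (act x U)
  ≈[ H₀⊗H₀ ] to (prepends₂ (u ++ [ x ]) v) U TT.+ᴹ to (prepends₂ u (v ++ [ x ])) U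
prepends₂-act x u v = presented-ext (prepends₂ u v ∘ˡ actˡ x)
  (LeftModule._+ᴹ_ (Hom H₀⊗H₀ H₀⊗H₀) (prepends₂ (u ++ [ x ]) v) (prepends₂ u (v ++ [ x ])))
  (λ (a , b) → TT.≈ᴹ-reflexive (≡.cong₂ TT._+ᴹ_
    (≡.cong (_⊗ to (prependsᴴ v) b) (≡.sym (prependsᴴ-∷ʳ u x a)))
    (≡.cong (to (prependsᴴ u) a ⊗_) (≡.sym (prependsᴴ-∷ʳ v x b)))))

act-prepends₂ : ∀ x u v U → act x (to (prepends₂ u v) U)
  ≈[ H₀⊗H₀ ] to (prepends₂ (x ∷ u) v) U TT.+ᴹ to (prepends₂ u (x ∷ v)) U
act-prepends₂ x u v = presented-ext (actˡ x ∘ˡ prepends₂ u v)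
  (LeftModule._+ᴹ_ (Hom H₀⊗H₀ H₀⊗H₀) (prepends₂ (x ∷ u) v) (prepends₂ u (x ∷ v)))
  (λ _ → TT.≈ᴹ-refl)

prepends₂-[] : ∀ U → to (prepends₂ [] []) U ≈[ H₀⊗H₀ ] U
prepends₂-[] = presented-ext (prepends₂ [] []) idˡ (λ _ → TT.≈ᴹ-refl)

-- Iterated letters: the binomial theorem for d^k and d^k y.

acts : Word → LinearMap H₀⊗H₀ H₀⊗H₀
acts = foldr (λ x f → actˡ x ∘ˡ f) idˡ

acts-++ : ∀ u v U → to (acts (u ++ v)) U ≡ to (acts u) (to (acts v) U)
acts-++ []      v U = refl
acts-++ (x ∷ u) v U = ≡.cong (act x) (acts-++ u v U)

primʷ-++ : ∀ u v → primʷ (u ++ v) ≡ to (acts u) (primʷ v)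
primʷ-++ []      v = refl
primʷ-++ (x ∷ u) v = ≡.cong (act x) (primʷ-++ u v)

-- The hypothesis turns one more `act d` into the recursion step of `pascal`. Keeping the family
-- abstract serves both the prepending maps and the symmetrised tensors.
acts-dⁿ : ∀ k (f : ℕ → ℕ → ∣ H₀⊗H₀ ∣ᴹ) →
          (∀ i j → act d (f i j) ≈[ H₀⊗H₀ ] f (suc i) j TT.+ᴹ f i (suc j)) →
          to (acts (dⁿ k)) (f 0 0) ≈[ H₀⊗H₀ ] pascal k f
acts-dⁿ zero    f p = TT.≈ᴹ-refl
acts-dⁿ (suc k) f p = begin
  act d (to (acts (dⁿ k)) (f 0 0))     ≈⟨ LinearMap.cong (actˡ d) (acts-dⁿ k f p) ⟩
  act d (pascal k f)                   ≈⟨ pascal-linear (actˡ d) k f ⟩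
  pascal k (λ i j → act d (f i j))     ≈⟨ pascal-cong k p ⟩
  pascal k (λ i j → f (suc i) j TT.+ᴹ f i (suc j)) ≈⟨ pascal-+ k _ _ ⟩
  pascal (suc k) f                     ∎

distribute : ℕ × ℕ → LinearMap H₀⊗H₀ H₀⊗H₀
distribute (i , j) =
  LeftModule._+ᴹ_ (Hom H₀⊗H₀ H₀⊗H₀) (prepends₂ (dⁿ i) (dⁿy j)) (prepends₂ (dⁿy j) (dⁿ i))

acts-dⁿy : ∀ k U → to (acts (dⁿy k)) U
           ≈[ H₀⊗H₀ ] ⨁ (splits k) (λ (i , j) → (k C i) · to (distribute (i , j)) U)
acts-dⁿy k U = begin
  to (acts (dⁿy k)) U
    ≡⟨ acts-++ (dⁿ k) [ y ] U ⟩
  to (acts (dⁿ k)) (act y U)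
    -- The inserted identity is the member i = j = 0 from which `acts-dⁿ` starts.
    ≈⟨ LinearMap.cong (acts (dⁿ k)) (TT.≈ᴹ-sym (prepends₂-[] (act y U))) ⟩
  to (acts (dⁿ k)) (to (prepends₂ [] []) (act y U))
    ≈⟨ acts-dⁿ k (λ i j → to (prepends₂ (dⁿ i) (dⁿ j)) (act y U))
         (λ i j → act-prepends₂ d (dⁿ i) (dⁿ j) (act y U)) ⟩
  pascal k (λ i j → to (prepends₂ (dⁿ i) (dⁿ j)) (act y U))
    ≈⟨ pascal-cong k (λ i j → prepends₂-act y (dⁿ i) (dⁿ j) U) ⟩
  pascal k (λ i j → L i j TT.+ᴹ R i j)
    ≈⟨ pascal-+ k L R ⟩
  pascal k L TT.+ᴹ pascal k R
    -- Where y falls on the left factor, i and j are swapped, so that j counts the d's in front of y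
    -- in both halves, as in `distributions`.
    ≈⟨ TT.+ᴹ-congʳ (pascal-flip k L) ⟩
  pascal k (λ i j → L j i) TT.+ᴹ pascal k R
    ≈⟨ TT.+ᴹ-comm _ _ ⟩
  pascal k R TT.+ᴹ pascal k (λ i j → L j i)
    ≈⟨ TT.≈ᴹ-sym (pascal-+ k R (λ i j → L j i)) ⟩
  pascal k (λ i j → to (distribute (i , j)) U)
    ≈⟨ pascal≈∑splits k _ ⟩
  ⨁ (splits k) (λ (i , j) → (k C i) · to (distribute (i , j)) U) ∎
  where
  L R : ℕ → ℕ → ∣ H₀⊗H₀ ∣ᴹ
  L i j = to (prepends₂ (dⁿy i) (dⁿ j)) U
  R i j = to (prepends₂ (dⁿ i) (dⁿy j)) U

-- Symmetrised tensors and the first sum.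

act-⊗sym : ∀ x u v → act x (u ⊗sym v) ≈[ H₀⊗H₀ ] ((x ∷ u) ⊗sym v) TT.+ᴹ (u ⊗sym (x ∷ v))
act-⊗sym x u v = TT.≈ᴹ-trans (TT.+ᴹ-congˡ (TT.+ᴹ-comm _ _)) (+-interchange H₀⊗H₀ _ _ _ _)

acts-dⁿ-⊗sym : ∀ k u v → to (acts (dⁿ k)) (u ⊗sym v)
               ≈[ H₀⊗H₀ ] ⨁ (splits k) (λ (i , j) → (k C i) · (dⁿ i ++ u) ⊗sym (dⁿ j ++ v))
acts-dⁿ-⊗sym k u v = TT.≈ᴹ-trans
  (acts-dⁿ k (λ i j → (dⁿ i ++ u) ⊗sym (dⁿ j ++ v)) (λ i j → act-⊗sym d (dⁿ i ++ u) (dⁿ j ++ v)))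
  (pascal≈∑splits k _)

-- A d acting on the empty word produces the word d, whose class is zero; only the action on the
-- other factor survives.
[]-⊗sym-dⁿ : ∀ k v → to (acts (dⁿ k)) ([] ⊗sym v) ≈[ H₀⊗H₀ ] [] ⊗sym (dⁿ k ++ v)
[]-⊗sym-dⁿ zero    v = TT.≈ᴹ-refl
[]-⊗sym-dⁿ (suc k) v = begin
  act d (to (acts (dⁿ k)) ([] ⊗sym v))        ≈⟨ LinearMap.cong (actˡ d) ([]-⊗sym-dⁿ k v) ⟩
  act d ([] ⊗sym w)                           ≈⟨ act-⊗sym d [] w ⟩
  ([ d ] ⊗sym w) TT.+ᴹ ([] ⊗sym (d ∷ w))      ≈⟨ TT.+ᴹ-congʳ (TT.+ᴹ-cong
                                                   (⊗-0ˡ (word w) (word-0 []))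
                                                   (⊗-0ʳ (word w) (word-0 []))) ⟩
  (TT.0ᴹ TT.+ᴹ TT.0ᴹ) TT.+ᴹ ([] ⊗sym (d ∷ w)) ≈⟨ TT.+ᴹ-congʳ (TT.+ᴹ-identityˡ TT.0ᴹ) ⟩
  TT.0ᴹ TT.+ᴹ ([] ⊗sym (d ∷ w))               ≈⟨ TT.+ᴹ-identityˡ _ ⟩
  [] ⊗sym (d ∷ w)                             ∎
  where
  w : Word
  w = dⁿ k ++ v

acts-dⁿy-[]-⊗sym : ∀ {n} k (ks : Vec ℕ n) → to (acts (dⁿy k)) ([] ⊗sym w⋯ (toList ks))
  ≈[ H₀⊗H₀ ] ([] ⊗sym w⋯ (toList (k ∷ ks))) TT.+ᴹ firstSum (k ∷ ks)
acts-dⁿy-[]-⊗sym k ks = begin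
  to (acts (dⁿy k)) ([] ⊗sym w)
    ≡⟨ acts-++ (dⁿ k) [ y ] _ ⟩
  to D (act y ([] ⊗sym w))
    ≈⟨ LinearMap.cong D (act-⊗sym y [] w) ⟩
  to D (([ y ] ⊗sym w) TT.+ᴹ ([] ⊗sym (y ∷ w)))
    ≈⟨ LinearMap.+ᴹ-homo D _ _ ⟩
  to D ([ y ] ⊗sym w) TT.+ᴹ to D ([] ⊗sym (y ∷ w))
    ≈⟨ TT.+ᴹ-cong (acts-dⁿ-⊗sym k [ y ] w) ([]-⊗sym-dⁿ k (y ∷ w)) ⟩
  firstSum (k ∷ ks) TT.+ᴹ ([] ⊗sym (dⁿ k ++ y ∷ w))
    ≈⟨ TT.+ᴹ-comm _ _ ⟩
  ([] ⊗sym (dⁿ k ++ y ∷ w)) TT.+ᴹ firstSum (k ∷ ks)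
    ≡⟨ ≡.cong (λ v → ([] ⊗sym v) TT.+ᴹ firstSum (k ∷ ks)) (≡.sym (List.++-assoc (dⁿ k) [ y ] w)) ⟩
  ([] ⊗sym w⋯ (toList (k ∷ ks))) TT.+ᴹ firstSum (k ∷ ks) ∎
  where
  w : Word
  w = w⋯ (toList ks)
  D : LinearMap H₀⊗H₀ H₀⊗H₀
  D = acts (dⁿ k)

-- The p-sums.

-- Index zero means p = 1: no block comes before, so the outer and innermost sums have a single term
-- and the binomial product is 1. Thus the first sum can be treated as one more p-sum.
pSum-zero : ∀ {n} (k : Vec ℕ (suc n)) → pSum k zero ≈[ H₀⊗H₀ ] firstSum k
pSum-zero (k ∷ ks) = TT.≈ᴹ-trans (TT.+ᴹ-identityʳ _) (∑-cong (splits k) (λ (i , j) →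
  TT.≈ᴹ-trans (TT.*ₗ-congˡ (TT.+ᴹ-identityʳ _))
    (TT.≈ᴹ-reflexive (≡.cong (_· _) (ℕ.*-identityˡ (k C i))))))

-- Both `distribute` and `_⊗sym_` are symmetric in the two factors, so the four tensors pair off
-- into mirror images: `a` with `e` and `c` with `b`.
distribute-⊗sym : ∀ i j u v → to (distribute (i , j)) (u ⊗sym v)
  ≈[ H₀⊗H₀ ] ((dⁿ i ++ u) ⊗sym (dⁿy j ++ v)) TT.+ᴹ ((dⁿy j ++ u) ⊗sym (dⁿ i ++ v))
distribute-⊗sym i j u v = begin
  to (distribute (i , j)) (u ⊗sym v)
    ≡⟨ ≡.cong₂ TT._+ᴹ_
         (≡.cong₂ TT._+ᴹ_ (prepends₂-⊗ʷ (dⁿ i) (dⁿy j) u v) (prepends₂-⊗ʷ (dⁿ i) (dⁿy j) v u))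
         (≡.cong₂ TT._+ᴹ_ (prepends₂-⊗ʷ (dⁿy j) (dⁿ i) u v) (prepends₂-⊗ʷ (dⁿy j) (dⁿ i) v u)) ⟩
  (a TT.+ᴹ b) TT.+ᴹ (c TT.+ᴹ e) ≈⟨ TT.+ᴹ-congˡ (TT.+ᴹ-comm c e) ⟩
  (a TT.+ᴹ b) TT.+ᴹ (e TT.+ᴹ c) ≈⟨ +-interchange H₀⊗H₀ a b e c ⟩
  (a TT.+ᴹ e) TT.+ᴹ (b TT.+ᴹ c) ≈⟨ TT.+ᴹ-congˡ (TT.+ᴹ-comm b c) ⟩
  (a TT.+ᴹ e) TT.+ᴹ (c TT.+ᴹ b) ∎
  where
  a b c e : ∣ H₀⊗H₀ ∣ᴹ
  a = (dⁿ i ++ u) ⊗ʷ (dⁿy j ++ v)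
  b = (dⁿ i ++ v) ⊗ʷ (dⁿy j ++ u)
  c = (dⁿy j ++ u) ⊗ʷ (dⁿ i ++ v)
  e = (dⁿy j ++ v) ⊗ʷ (dⁿ i ++ u)

distributions-∷ : ∀ i j ijs a b →
  to (distribute (i , j)) (⨁ (distributions ijs) (λ (u , v) → (u ++ a) ⊗sym (v ++ b)))
  ≈[ H₀⊗H₀ ] ⨁ (distributions ((i , j) ∷ ijs)) (λ (u , v) → (u ++ a) ⊗sym (v ++ b))
distributions-∷ i j ijs a b = begin
  to (distribute (i , j)) (⨁ uvs f)
    ≈⟨ ∑-linear (distribute (i , j)) uvs f ⟩
  ⨁ uvs (λ (u , v) → to (distribute (i , j)) ((u ++ a) ⊗sym (v ++ b)))
    ≈⟨ ∑-cong uvs (λ (u , v) → TT.≈ᴹ-trans (distribute-⊗sym i j (u ++ a) (v ++ b))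
         (TT.≈ᴹ-reflexive (≡.cong₂ TT._+ᴹ_
           (≡.sym (≡.cong₂ _⊗sym_ (List.++-assoc (dⁿ i) u a) (List.++-assoc (dⁿy j) v b)))
           (≡.sym (≡.cong₂ _⊗sym_ (List.++-assoc (dⁿy j) u a) (List.++-assoc (dⁿ i) v b)))))) ⟩
  ⨁ uvs (λ (u , v) → f (dⁿ i ++ u , dⁿy j ++ v) TT.+ᴹ f (dⁿy j ++ u , dⁿ i ++ v))
    ≈⟨ ∑-+ uvs _ _ ⟩
  ⨁ uvs (λ (u , v) → f (dⁿ i ++ u , dⁿy j ++ v)) TT.+ᴹ ⨁ uvs (λ (u , v) → f (dⁿy j ++ u , dⁿ i ++ v))
    -- The sum over the two-element list `choices` unfolds with a trailing zero.
    ≈⟨ TT.+ᴹ-congˡ (TT.≈ᴹ-sym (TT.+ᴹ-identityʳ _)) ⟩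
  ⨁ choices (λ (u , v) → ⨁ uvs (λ (u′ , v′) → f (u ++ u′ , v ++ v′)))
    ≈⟨ TT.≈ᴹ-sym (∑-cartesianProductWith (λ (u , v) (u′ , v′) → u ++ u′ , v ++ v′) choices uvs f) ⟩
  ⨁ (distributions ((i , j) ∷ ijs)) f ∎
  where
  f : Word × Word → ∣ H₀⊗H₀ ∣ᴹ
  f (u , v) = (u ++ a) ⊗sym (v ++ b)
  uvs choices : List (Word × Word)
  uvs     = distributions ijs
  choices = (dⁿ i , dⁿy j) ∷ (dⁿy j , dⁿ i) ∷ []

-- By computation, a new first block k extends `before` by k and keeps `kₚ` and `after`. It remains
-- to move the block operator inside the sums, where its binomial weight joins `∏binom` and its two
-- terms extend `distributions`.
acts-dⁿy-pSum : ∀ {n} k (ks : Vec ℕ n) c →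
                to (acts (dⁿy k)) (pSum ks c) ≈[ H₀⊗H₀ ] pSum (k ∷ ks) (suc c)
acts-dⁿy-pSum k ks c = begin
  to (acts (dⁿy k)) (pSum ks c)
    ≈⟨ acts-dⁿy k (pSum ks c) ⟩
  ⨁ (splits k) (λ (i , j) → (k C i) · to (distribute (i , j)) (pSum ks c))
    ≈⟨ ∑-cong (splits k) (λ (i , j) → begin
      (k C i) · to (distribute (i , j)) (pSum ks c)
        ≈⟨ ∑-linear (E i j) (multisplits before) _ ⟩
      ⨁ (multisplits before) (λ ijs → to (E i j) (⨁ (splits kₚ) (summand before ijs)))
        ≈⟨ ∑-cong (multisplits before) (λ ijs → TT.≈ᴹ-trans
             (∑-linear (E i j) (splits kₚ) (summand before ijs))
             (∑-cong (splits kₚ) (step i j ijs))) ⟩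
      ⨁ (multisplits before) (λ ijs → ⨁ (splits kₚ) (summand (k ∷ before) ((i , j) ∷ ijs))) ∎) ⟩
  ⨁ (splits k) (λ ij → ⨁ (multisplits before) (λ ijs →
    ⨁ (splits kₚ) (summand (k ∷ before) (ij ∷ ijs))))
    ≈⟨ TT.≈ᴹ-sym (∑-cartesianProductWith _∷_ (splits k) (multisplits before) _) ⟩
  pSum (k ∷ ks) (suc c) ∎
  where
  before after : List ℕ
  before = take (toℕ c) (toList ks)
  after  = drop (suc (toℕ c)) (toList ks)
  kₚ : ℕ
  kₚ = lookup ks c

  tensors : List (ℕ × ℕ) → ℕ × ℕ → ∣ H₀⊗H₀ ∣ᴹ
  tensors ijs (iₚ , jₚ) = ⨁ (distributions ijs) (λ (u , v) →
    (u ++ dⁿy iₚ) ⊗sym (v ++ dⁿ jₚ ++ w⋯ after))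

  summand : List ℕ → List (ℕ × ℕ) → ℕ × ℕ → ∣ H₀⊗H₀ ∣ᴹ
  summand ks′ ijs (iₚ , jₚ) = (∏binom ks′ ijs * (kₚ C iₚ)) · tensors ijs (iₚ , jₚ)

  -- Weight and distribution form one linear map, so that `∑-linear` carries both through each sum.
  E : ℕ → ℕ → LinearMap H₀⊗H₀ H₀⊗H₀
  E i j = LeftModule._*ₗ_ (Hom H₀⊗H₀ H₀⊗H₀) ((+ (k C i)) / 1) (distribute (i , j))

  step : ∀ i j ijs s → to (E i j) (summand before ijs s)
                       ≈[ H₀⊗H₀ ] summand (k ∷ before) ((i , j) ∷ ijs) s
  step i j ijs (iₚ , jₚ) = begin
    (k C i) · to (distribute (i , j)) (b · tensors ijs (iₚ , jₚ))
      ≈⟨ TT.*ₗ-congˡ (LinearMap.*ₗ-homo (distribute (i , j)) _ (tensors ijs (iₚ , jₚ))) ⟩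
    (k C i) · b · to (distribute (i , j)) (tensors ijs (iₚ , jₚ))
      ≈⟨ TT.*ₗ-congˡ (TT.*ₗ-congˡ (distributions-∷ i j ijs (dⁿy iₚ) (dⁿ jₚ ++ w⋯ after))) ⟩
    (k C i) · b · tensors ((i , j) ∷ ijs) (iₚ , jₚ)
      ≈⟨ TT.≈ᴹ-sym (·-* (k C i) b _) ⟩
    ((k C i) * b) · tensors ((i , j) ∷ ijs) (iₚ , jₚ)
      ≡⟨ ≡.cong (_· tensors ((i , j) ∷ ijs) (iₚ , jₚ))
           (≡.sym (ℕ.*-assoc (k C i) (∏binom before ijs) (kₚ C iₚ))) ⟩
    summand (k ∷ before) ((i , j) ∷ ijs) (iₚ , jₚ) ∎
    where
    b : ℕ
    b = ∏binom before ijs * (kₚ C iₚ)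

-- Induction on the number of blocks, and the reduced coproduct.

-- There are `suc n` blocks, and `inject₁` omits the last index, so p runs from 1 to n. Including p
-- = 1 lets the induction start at one block, where the sum is empty and d^k y is primitive.
primʷ-w⋯ : ∀ {n} (k : Vec ℕ (suc n)) → primʷ (w⋯ (toList k))
  ≈[ H₀⊗H₀ ] ([] ⊗sym w⋯ (toList k)) TT.+ᴹ ⨁ (allFin n) (λ r → pSum k (inject₁ r))
primʷ-w⋯ (k ∷ []) = begin
  primʷ (dⁿy k ++ [])                         ≡⟨ ≡.cong primʷ (List.++-assoc (dⁿ k) [ y ] []) ⟩
  primʷ (dⁿy k)                               ≡⟨ primʷ-++ (dⁿ k) [ y ] ⟩
  to (acts (dⁿ k)) ([ y ] ⊗ʷ [] TT.+ᴹ [] ⊗ʷ [ y ])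
    ≈⟨ LinearMap.cong (acts (dⁿ k)) (TT.+ᴹ-comm ([ y ] ⊗ʷ []) ([] ⊗ʷ [ y ])) ⟩
  to (acts (dⁿ k)) ([] ⊗sym [ y ])            ≈⟨ []-⊗sym-dⁿ k [ y ] ⟩
  [] ⊗sym dⁿy k                               ≡⟨ ≡.cong ([] ⊗sym_) (≡.sym (List.++-identityʳ (dⁿy k))) ⟩
  [] ⊗sym (dⁿy k ++ [])                       ≈⟨ TT.≈ᴹ-sym (TT.+ᴹ-identityʳ _) ⟩
  ([] ⊗sym (dⁿy k ++ [])) TT.+ᴹ TT.0ᴹ         ∎
primʷ-w⋯ {suc n} (k ∷ ks@(_ ∷ _)) = begin
  primʷ (dⁿy k ++ w⋯ (toList ks))
    ≡⟨ primʷ-++ (dⁿy k) _ ⟩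
  to B (primʷ (w⋯ (toList ks)))
    ≈⟨ LinearMap.cong B (primʷ-w⋯ ks) ⟩
  to B (([] ⊗sym w⋯ (toList ks)) TT.+ᴹ ⨁ (allFin n) (λ r → pSum ks (inject₁ r)))
    ≈⟨ LinearMap.+ᴹ-homo B _ _ ⟩
  to B ([] ⊗sym w⋯ (toList ks)) TT.+ᴹ to B (⨁ (allFin n) (λ r → pSum ks (inject₁ r)))
    -- The leading tensor yields the new term p = 1, while each old term p becomes the term p + 1.
    ≈⟨ TT.+ᴹ-cong (acts-dⁿy-[]-⊗sym k ks) (TT.≈ᴹ-trans
         (∑-linear B (allFin n) (λ r → pSum ks (inject₁ r)))
         (∑-cong (allFin n) (λ r → acts-dⁿy-pSum k ks (inject₁ r)))) ⟩
  (W TT.+ᴹ firstSum (k ∷ ks)) TT.+ᴹ P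
    ≈⟨ TT.+ᴹ-assoc W _ P ⟩
  W TT.+ᴹ (firstSum (k ∷ ks) TT.+ᴹ P)
    ≈⟨ TT.+ᴹ-congˡ (TT.+ᴹ-congʳ (TT.≈ᴹ-sym (pSum-zero (k ∷ ks)))) ⟩
  W TT.+ᴹ (pSum (k ∷ ks) zero TT.+ᴹ P)
    ≈⟨ TT.+ᴹ-congˡ (TT.≈ᴹ-sym (∑-allFin-suc n (λ r → pSum (k ∷ ks) (inject₁ r)))) ⟩
  W TT.+ᴹ ⨁ (allFin (suc n)) (λ r → pSum (k ∷ ks) (inject₁ r)) ∎
  where
  B : LinearMap H₀⊗H₀ H₀⊗H₀
  B = acts (dⁿy k)
  W P : ∣ H₀⊗H₀ ∣ᴹ
  W = [] ⊗sym w⋯ (toList (k ∷ ks))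
  P = ⨁ (allFin n) (λ r → pSum (k ∷ ks) (suc (inject₁ r)))

proposition2p5 : (m : ℕ) (k : Vec ℕ (2 + m)) →
    to Δ̃₀ (word (w⋯ (toList k)))
    ≈[ H₀⊗H₀ ]
    LeftModule._+ᴹ_ H₀⊗H₀ (firstSum k) (∑ H₀⊗H₀ (allFin m) (λ r → pSum k (suc (inject₁ r))))
proposition2p5 m k = begin
  (Δ₀ʷ w TT.+ᴹ TT.-ᴹ ([] ⊗ʷ w)) TT.+ᴹ TT.-ᴹ (w ⊗ʷ [])
    ≈⟨ TT.+ᴹ-assoc _ _ _ ⟩
  Δ₀ʷ w TT.+ᴹ (TT.-ᴹ ([] ⊗ʷ w) TT.+ᴹ TT.-ᴹ (w ⊗ʷ []))
    ≈⟨ TT.+ᴹ-congˡ (TT.≈ᴹ-sym (neg-+ H₀⊗H₀ _ _)) ⟩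
  Δ₀ʷ w TT.+ᴹ TT.-ᴹ ([] ⊗sym w)
    -- The two subtracted tensors are exactly the leading `[] ⊗sym w` of `primʷ-w⋯`.
    ≈⟨ +-cancel H₀⊗H₀ (TT.≈ᴹ-trans (Δ₀ʷ-prim w) (TT.≈ᴹ-trans (primʷ-w⋯ k) (TT.+ᴹ-comm _ _))) ⟩
  ⨁ (allFin (suc m)) (λ r → pSum k (inject₁ r))
    -- Splitting off p = 1 leaves p = r + 2 for r below m, that is p = 2, ..., n - 1 with n = m + 2.
    ≈⟨ ∑-allFin-suc m (λ r → pSum k (inject₁ r)) ⟩
  pSum k zero TT.+ᴹ ⨁ (allFin m) (λ r → pSum k (suc (inject₁ r)))
    ≈⟨ TT.+ᴹ-congʳ (pSum-zero k) ⟩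
  firstSum k TT.+ᴹ ⨁ (allFin m) (λ r → pSum k (suc (inject₁ r))) ∎
  where
  w : Word
  w = w⋯ (toList k)
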